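{- Let $n\ge2$ and $\pi,\tau\in S_n$. Then $\pi\sim\tau$ if and only if $\tau$ can be obtained from $\pi$ by a sequence of valid flips, i.e. there exist $\pi_0=\pi,\pi_1,\dots,\pi_l=\tau\in S_n$ ($l\ge0$) and, for each $1\le r\le l$, a flip $\varphi_r$ that is a valid flip with respect to $\pi_{r-1}$ such that $\{(\varphi_r(S^{\pi_{r-1}}_m),\varepsilon^{\pi_{r-1}}_m):1\le m\le n-1\}=\{(S^{\pi_r}_m,\varepsilon^{\pi_r}_m):1\le m\le n-1\}$.
   Context: For $x=(x_1,\dots,x_{n-1})\in\mathbb{R}^{n-1}$ put $Z_0=0$ and $Z_i=x_1+\dots+x_i$. If $Z_0,\dots,Z_{n-1}$ are pairwise distinct, let $p(x)\in S_n$ be the permutation with the same relative order as $(Z_0,\dots,Z_{n-1})$, i.e. $p(x)(i)=|\{k: Z_k\le Z_{i-1}\}|$; otherwise $p(x)$ is undefined (and "$p(x)=\pi$" is false). Write $\pi\sim\tau$ if there is $\rho\in S_{n-1}$ such that for all $x\in\mathbb{R}^{n-1}$: $p(x_1,\dots,x_{n-1})=\pi$ iff $p(x_{\rho(1)},\dots,x_{\rho(n-1)})=\tau$. For $1\le s<t\le n$, the interval $[s,t]$ has level set $\Lambda_{[s,t]}=\{s,\dots,t-1\}$. For $\pi\in S_n$ and $1\le m\le n-1$, $S^\pi_m=\Lambda_{[\min(\pi(m),\pi(m+1)),\max(\pi(m),\pi(m+1))]}$ and $\varepsilon^\pi_m=\operatorname{sgn}(\pi(m+1)-\pi(m))$;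 for $\sigma\in S_{n-1}$, $\sigma(S)=\{\sigma(x):x\in S\}$. The flip of $[i,j]$ ($1\le i<j\le n$) is $\varphi\in S_{n-1}$ with $\varphi(m)=i+j-1-m$ for $i\le m\le j-1$ and $\varphi(m)=m$ otherwise. It is a valid flip with respect to $\pi$ if, with $p<q$ such that $\{p,q\}=\{\pi(1),\pi(n)\}$: (a) $\Lambda_{[i,j]}\subseteq\Lambda_{[p,q]}$ or $\Lambda_{[p,q]}\subseteq\Lambda_{[i,j]}$ or $\Lambda_{[i,j]}\cap\Lambda_{[p,q]}=\emptyset$; and (b) for every $m$, $S^\pi_m\subseteq\Lambda_{[i,j]}$ or $\Lambda_{[i,j]}\subseteq S^\pi_m$ or $S^\pi_m\cap\Lambda_{[i,j]}=\emptyset$.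
   Formalization: In the definition of π∼τ, the vectors x range over rational vectors in ℚ^{n−1} instead of real vectors in ℝ^{n−1}. -}

module Defs where

-- Conventions: everything is 0-based.  S_n is Permutation′ n with
-- n = suc m (so m = n-1 ≥ 1).  Position i ∈ {1..n} of the paper is
-- Fin n value i-1; value π(i) ∈ {1..n} is the Fin n value π(i)-1.
-- Levels {1..n-1} are ℕ values 0..m-1 (level ℓ ↦ ℓ-1).

open import Data.Nat using (ℕ; zero; suc; _+_; _∸_; _≤_; _<_; _≤ᵇ_; _<ᵇ_; _⊓_; _⊔_)
open import Data.Bool using (Bool; true; false; if_then_else_; _∧_)
open import Data.Fin using (Fin; zero; suc; toℕ; inject₁; fromℕ)
open import Data.Fin.Permutation using (Permutation′; _⟨$⟩ʳ_)
open import Data.List using (List; length; filter)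
open import Data.List using (allFin)
open import Data.Rational using (ℚ; 0ℚ) renaming (_+_ to _+ℚ_)
open import Data.Rational.Properties using (_≤?_)
open import Data.Product using (Σ; ∃; _×_; _,_; proj₁; proj₂)
open import Data.Sum using (_⊎_)
open import Data.Empty using (⊥)
open import Data.Sign using (Sign)
open import Relation.Binary.PropositionalEquality using (_≡_)
open import Relation.Binary.Construct.Closure.ReflexiveTransitive using (Star)
open import Function.Bundles using (_⇔_)

Z : ∀ {m} → (Fin m → ℚ) → Fin (suc m) → ℚ
Z x zero = 0ℚ
Z {suc m} x (suc k) = x zero +ℚ Z (λ j → x (suc j)) k

countLe : ∀ {m} → (Fin m → ℚ) → Fin (suc m) → ℕ
countLe {m} x i = length (filter (λ k → Z x k ≤? Z x i) (allFin (suc m)))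

-- "p(x) = π": partial sums pairwise distinct and
-- p(x)(i) = |{k : Z_k ≤ Z_{i-1}}|  (in 0-based form: 1 + π i = count)
PEq : ∀ {m} → (Fin m → ℚ) → Permutation′ (suc m) → Set
PEq x π =
  (∀ i j → Z x i ≡ Z x j → i ≡ j) ×
  (∀ i → suc (toℕ (π ⟨$⟩ʳ i)) ≡ countLe x i)

-- π ∼ τ  (real vectors replaced by rational vectors)
_∼_ : ∀ {m} → Permutation′ (suc m) → Permutation′ (suc m) → Set
_∼_ {m} π τ = Σ (Permutation′ m) λ ρ →
  ∀ (x : Fin m → ℚ) → PEq x π ⇔ PEq (λ k → x (ρ ⟨$⟩ʳ k)) τ

LSet : Set₁
LSet = ℕ → Set

-- Λ a b = 0-based level set of the interval with 0-based endpoints a<b: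
-- levels ℓ with a ≤ ℓ < b  (paper: Λ_[s,t] = {s..t-1}, s=a+1, t=b+1)
Λ : ℕ → ℕ → LSet
Λ a b ℓ = a ≤ ℓ × ℓ < b

_⊆_ : LSet → LSet → Set
A ⊆ B = ∀ ℓ → A ℓ → B ℓ

Disjoint : LSet → LSet → Set
Disjoint A B = ∀ ℓ → A ℓ → B ℓ → ⊥

_≐_ : LSet → LSet → Set
A ≐ B = ∀ ℓ → (A ℓ → B ℓ) × (B ℓ → A ℓ)

Laminar : LSet → LSet → Set
Laminar A B = A ⊆ B ⊎ B ⊆ A ⊎ Disjoint A B

image : (ℕ → ℕ) → LSet → LSet
image σ S y = ∃ λ x → S x × σ x ≡ y

-- S^π_k and ε^π_k  (k : Fin m, i.e. paper index k+1, positions k+1,k+2)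

val : ∀ {m} → Permutation′ (suc m) → Fin (suc m) → ℕ
val π i = toℕ (π ⟨$⟩ʳ i)

Sπ : ∀ {m} → Permutation′ (suc m) → Fin m → LSet
Sπ π k = Λ (val π (inject₁ k) ⊓ val π (suc k)) (val π (inject₁ k) ⊔ val π (suc k))

-- sgn(π(k+1) - π(k)); never 0 since π injective
επ : ∀ {m} → Permutation′ (suc m) → Fin m → Sign
επ π k = if val π (inject₁ k) <ᵇ val π (suc k) then Sign.+ else Sign.-

-- flip of [i,j] (0-based endpoints a = i-1 < b = j-1), acting on 0-based
-- levels: ℓ ↦ a + b - 1 - ℓ for a ≤ ℓ < b, identity otherwise
flipFun : ℕ → ℕ → ℕ → ℕ
flipFun a b ℓ = if (a ≤ᵇ ℓ) ∧ (ℓ <ᵇ b) then (a + b) ∸ suc ℓ else ℓ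

firstLast : ∀ {m} → Permutation′ (suc m) → ℕ × ℕ
firstLast {m} π = (val π zero ⊓ val π (fromℕ m)) , (val π zero ⊔ val π (fromℕ m))

ValidFlip : ∀ {m} → Permutation′ (suc m) → ℕ → ℕ → Set
ValidFlip {m} π a b =
  Laminar (Λ a b) (Λ (proj₁ (firstLast π)) (proj₂ (firstLast π))) ×
  (∀ (k : Fin m) → Laminar (Sπ π k) (Λ a b))

SameFlippedPairs : ∀ {m} → (ℕ → ℕ) → Permutation′ (suc m) → Permutation′ (suc m) → Set
SameFlippedPairs {m} φ π τ =
  (∀ (k : Fin m) → ∃ λ (k' : Fin m) → image φ (Sπ π k) ≐ Sπ τ k' × επ π k ≡ επ τ k') ×
  (∀ (k' : Fin m) → ∃ λ (k : Fin m) → image φ (Sπ π k) ≐ Sπ τ k' × επ π k ≡ επ τ k')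

-- one valid-flip step: flip of [i,j], 1 ≤ i < j ≤ n, i.e. 0 ≤ a < b ≤ m
FlipStep : ∀ {m} → Permutation′ (suc m) → Permutation′ (suc m) → Set
FlipStep {m} π τ = Σ ℕ λ a → Σ ℕ λ b →
  a < b × b ≤ m × ValidFlip π a b × SameFlippedPairs (flipFun a b) π τ

FlipReachable : ∀ {m} → Permutation′ (suc m) → Permutation′ (suc m) → Set
FlipReachable = Star FlipStep

{-# OPTIONS --safe #-}

-- Let D^π be the matrix with rows ε_k 1_{S_k}.  In the coordinates W(v) = Z(π⁻¹ v), the condition p(x) = π says that W
-- is increasing, and the elementary steps W = 1_{v > ℓ} give the columns of D^π.  If π ∼ τ, the change of coordinates
-- and its inverse both preserve increasing W, so they permute the elementary steps; hence π ∼ τ exactly when D^π and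
-- D^τ agree up to a permutation ρ of the rows and a permutation σ of the columns (levels).  Summing the rows shows that
-- σ then also respects the interval between π(1) and π(n), so we may speak of the closed path.
--
-- For a flip of [i,j] satisfying (a) and (b), each of the two arcs of the closed path between i and j lies inside or
-- outside (i,j); reflecting the values on the inner arcs while traversing them backwards gives the new permutation.
--
-- It remains to sort σ by valid flips.  Suppose σ fixes all levels before j but not j, and let t = σ⁻¹(j).  Take the
-- least β ≥ t such that every set of the family containing β and β + 1 also contains j.  All sets of the family are
-- convex both for the order of π and, through σ, for that of τ, which shows that reversing the levels from j to β is a
-- valid flip and that σ(β) < σ(j); so σ(j) decreases until it equals j.
module Submission where

open import Defs
open import Data.Nat using (ℕ; zero; suc; z≤n; s≤s; _+_; _∸_; _⊓_; _⊔_; _≤_; _<_; _≤?_; _<?_; _<ᵇ_; _≤ᵇ_)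
import Data.Nat.Properties as ℕₚ
open import Data.Bool using (true; false; if_then_else_; T)
open import Data.Sign using (Sign)
open import Data.Fin using (Fin; zero; suc; toℕ; inject₁; fromℕ; fromℕ<)
open import Data.Fin.Properties using (toℕ-injective; toℕ<n; toℕ-inject₁; toℕ-fromℕ; toℕ-fromℕ<; fromℕ<-toℕ; any?)
  renaming (_≟_ to _≟F_)
open import Data.Fin.Permutation using (Permutation′; permutation; _⟨$⟩ʳ_; _⟨$⟩ˡ_; inverseˡ; inverseʳ; flip; _∘ₚ_)
import Data.Fin.Permutation as Permutation
open import Data.List using (length; filter; allFin; tabulate)
open import Data.List.Properties using (filter-≐)
import Data.List.Relation.Binary.Sublist.Propositional as Sublist
import Data.List.Relation.Binary.Sublist.Propositional.Properties as Sublistₚ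
open import Data.Rational using (ℚ; 0ℚ; 1ℚ; _*_; _-_; -_; positive; nonNegative)
  renaming (_+_ to _+ℚ_; _≤_ to _≤ℚ_; _<_ to _<ℚ_)
import Data.Rational.Properties as ℚₚ
open import Data.Rational.Solver using (module +-*-Solver)
open import Data.Product using (Σ; ∃; _×_; _,_; proj₁; proj₂)
open import Data.Sum using (_⊎_; inj₁; inj₂; [_,_]′)
open import Function using (_∘_; id; mk⇔)
open import Function.Bundles using (_⇔_; Equivalence)
open import Relation.Nullary using (¬_; Dec; yes; no; does; contradiction; ¬?; decidable-stable; _×-dec_)
open import Relation.Unary using (Decidable)
open import Relation.Binary.Construct.Closure.ReflexiveTransitive using (ε; _◅_)
open import Relation.Binary.Definitions using (Tri; tri<; tri≈; tri>)
open import Relation.Binary.PropositionalEquality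
  using (_≡_; _≢_; refl; sym; trans; cong; cong₂; subst; subst₂; module ≡-Reasoning)
import Algebra.Properties.CommutativeMonoid.Sum as Sum
open +-*-Solver using (solve; _:+_; _:*_; _:-_; :-_; _:=_; con)

module Σℕ = Sum ℕₚ.+-0-commutativeMonoid
module Σℚ = Sum ℚₚ.+-0-commutativeMonoid

-- The condition p(x) = π in terms of the order of the partial sums

val-injective : ∀ {m} (π : Permutation′ (suc m)) {i j} → val π i ≡ val π j → i ≡ j
val-injective π eq = trans (sym (inverseˡ π)) (trans (cong (π ⟨$⟩ˡ_) (toℕ-injective eq)) (inverseˡ π))

length-filter-tabulate : ∀ {A : Set} {P : A → Set} (P? : Decidable P) {n} (f : Fin n → A) →
  length (filter P? (tabulate f)) ≡ Σℕ.sum (λ i → if does (P? (f i)) then 1 else 0)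
length-filter-tabulate P? {zero} f = refl
length-filter-tabulate P? {suc n} f with does (P? (f zero))
... | true  = cong suc (length-filter-tabulate P? (f ∘ suc))
... | false = length-filter-tabulate P? (f ∘ suc)

sum-indicator-< : ∀ {n} w → w ≤ n → Σℕ.sum {n} (λ i → if toℕ i <ᵇ w then 1 else 0) ≡ w
sum-indicator-< {zero} zero z≤n = refl
sum-indicator-< {suc n} zero z≤n = sum-indicator-< {n} zero z≤n
sum-indicator-< {suc n} (suc w) (s≤s w≤n) = cong suc (sum-indicator-< w w≤n)

Ord : ∀ {m} → (Fin m → ℚ) → Permutation′ (suc m) → Set
Ord x π = ∀ i j → val π i < val π j → Z x i <ℚ Z x j

-- If `Z x j ≤ Z x i`, every index counted for `j` is also counted for `i`. The count for `j` is
-- then at most the count for `i`, against `val π i < val π j`.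
PEq⇒Ord : ∀ {m} (x : Fin m → ℚ) π → PEq x π → Ord x π
PEq⇒Ord {m} x π (_ , count) i j πi<πj with Z x i ℚₚ.<? Z x j
... | yes Zi<Zj = Zi<Zj
... | no Zi≮Zj = contradiction (subst₂ _≤_ (sym (count j)) (sym (count i)) count-mono) (ℕₚ.<⇒≱ (s≤s πi<πj))
  where
  count-mono : countLe x j ≤ countLe x i
  count-mono = Sublistₚ.length-mono-≤ (Sublistₚ.filter⁺ (λ k → Z x k ℚₚ.≤? Z x j) (λ k → Z x k ℚₚ.≤? Z x i)
    (λ { refl Zk≤Zj → ℚₚ.≤-trans Zk≤Zj (ℚₚ.≮⇒≥ Zi≮Zj) }) (Sublist.⊆-refl {x = allFin (suc m)}))

-- Under `Ord` the indices counted for `i` are exactly the `k` with `val π k ≤ val π i`. Reindexing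
-- the sum of indicators along `π` turns this into counting the numbers below `suc (val π i)`.
Ord⇒PEq : ∀ {m} (x : Fin m → ℚ) π → Ord x π → PEq x π
Ord⇒PEq {m} x π ord = distinct , count
  where
  distinct : ∀ i j → Z x i ≡ Z x j → i ≡ j
  distinct i j Zi≡Zj with ℕₚ.<-cmp (val π i) (val π j)
  ... | tri< lt _ _ = contradiction Zi≡Zj (ℚₚ.<⇒≢ (ord i j lt))
  ... | tri≈ _ eq _ = val-injective π eq
  ... | tri> _ _ gt = contradiction (sym Zi≡Zj) (ℚₚ.<⇒≢ (ord j i gt))

  reflects : ∀ i {k} → Z x k ≤ℚ Z x i → val π k < suc (val π i)
  reflects i {k} Zk≤Zi = s≤s (ℕₚ.≮⇒≥ (λ lt → ℚₚ.<-irrefl refl (ℚₚ.<-≤-trans (ord i k lt) Zk≤Zi)))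

  preserves : ∀ i {k} → val π k < suc (val π i) → Z x k ≤ℚ Z x i
  preserves i {k} (s≤s le) with ℕₚ.m≤n⇒m<n∨m≡n le
  ... | inj₁ lt = ℚₚ.<⇒≤ (ord k i lt)
  ... | inj₂ eq = ℚₚ.≤-reflexive (cong (Z x) (val-injective π eq))

  count : ∀ i → suc (val π i) ≡ countLe x i
  count i = sym (begin
    countLe x i
      ≡⟨ cong length (filter-≐ (λ k → Z x k ℚₚ.≤? Z x i) (λ k → val π k <? w) (reflects i , preserves i) (allFin _)) ⟩
    length (filter (λ k → val π k <? w) (allFin _))
      ≡⟨ length-filter-tabulate (λ k → val π k <? w) id ⟩
    Σℕ.sum (λ k → if val π k <ᵇ w then 1 else 0)
      ≡⟨ sym (Σℕ.sum-permute (λ v → if toℕ v <ᵇ w then 1 else 0) π) ⟩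
    Σℕ.sum {suc m} (λ v → if toℕ v <ᵇ w then 1 else 0)
      ≡⟨ sum-indicator-< w (toℕ<n (π ⟨$⟩ʳ i)) ⟩
    w ∎)
    where
    open ≡-Reasoning
    w : ℕ
    w = suc (val π i)

-- Coordinates on the cone of π

gap : ∀ {m} → (Fin (suc m) → ℚ) → Fin m → ℚ
gap W ℓ = W (suc ℓ) - W (inject₁ ℓ)

Strict Weak : ∀ {m} → (Fin (suc m) → ℚ) → Set
Strict W = ∀ ℓ → 0ℚ <ℚ gap W ℓ
Weak W = ∀ ℓ → 0ℚ ≤ℚ gap W ℓ

Z-cong : ∀ {m} {x y : Fin m → ℚ} → (∀ k → x k ≡ y k) → ∀ i → Z x i ≡ Z y i
Z-cong x≗y zero = refl
Z-cong {suc m} x≗y (suc i) = cong₂ _+ℚ_ (x≗y zero) (Z-cong (x≗y ∘ suc) i)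

Z-gap : ∀ {m} (W : Fin (suc m) → ℚ) i → Z (gap W) i ≡ W i - W zero
Z-gap W zero = sym (ℚₚ.+-inverseʳ (W zero))
Z-gap {suc m} W (suc i) = trans (cong (gap W zero +ℚ_) (Z-gap (W ∘ suc) i))
  (solve 3 (λ a b c → (b :- a) :+ (c :- b) := c :- a) refl (W zero) (W (suc zero)) (W (suc i)))

gap-Z : ∀ {m} (x : Fin m → ℚ) k → gap (Z x) k ≡ x k
gap-Z {suc m} x zero = solve 1 (λ a → (a :+ con 0ℚ) :- con 0ℚ := a) refl (x zero)
gap-Z {suc m} x (suc k) = trans
  (solve 3 (λ a b c → (a :+ b) :- (a :+ c) := b :- c) refl (x zero) (Z (x ∘ suc) (suc k)) (Z (x ∘ suc) (inject₁ k)))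
  (gap-Z (x ∘ suc) k)

Z-linear : ∀ {m} (c d : ℚ) (x y : Fin m → ℚ) i → Z (λ k → c * x k +ℚ d * y k) i ≡ c * Z x i +ℚ d * Z y i
Z-linear c d x y zero = solve 2 (λ c d → con 0ℚ := c :* con 0ℚ :+ d :* con 0ℚ) refl c d
Z-linear {suc m} c d x y (suc i) = trans (cong ((c * x zero +ℚ d * y zero) +ℚ_) (Z-linear c d (x ∘ suc) (y ∘ suc) i))
  (solve 6 (λ c d a b e f → (c :* a :+ d :* b) :+ (c :* e :+ d :* f) := c :* (a :+ e) :+ d :* (b :+ f))
    refl c d (x zero) (y zero) (Z (x ∘ suc) i) (Z (y ∘ suc) i))

gap-linear : ∀ {m} (c d : ℚ) (V W : Fin (suc m) → ℚ) ℓ → gap (λ v → c * V v +ℚ d * W v) ℓ ≡ c * gap V ℓ +ℚ d * gap W ℓ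
gap-linear c d V W ℓ = solve 6
  (λ c d a b e f → (c :* a :+ d :* b) :- (c :* e :+ d :* f) := c :* (a :- e) :+ d :* (b :- f))
  refl c d (V (suc ℓ)) (W (suc ℓ)) (V (inject₁ ℓ)) (W (inject₁ ℓ))

0<q-p⇒p<q : ∀ {p q} → 0ℚ <ℚ q - p → p <ℚ q
0<q-p⇒p<q {p} {q} lt = subst₂ _<ℚ_ (ℚₚ.+-identityˡ p)
  (solve 2 (λ p q → (q :- p) :+ p := q) refl p q) (ℚₚ.+-monoˡ-< p lt)

p<q⇒0<q-p : ∀ {p q} → p <ℚ q → 0ℚ <ℚ q - p
p<q⇒0<q-p {p} {q} lt = subst (_<ℚ q - p) (ℚₚ.+-inverseʳ p) (ℚₚ.+-monoˡ-< (- p) lt)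

Strict⇒increasing : ∀ {m} {W : Fin (suc m) → ℚ} → Strict W → ∀ {i j} → toℕ i < toℕ j → W i <ℚ W j
Strict⇒increasing {suc m} {W} W↑ {zero} {suc zero} _ = 0<q-p⇒p<q (W↑ zero)
Strict⇒increasing {suc m} {W} W↑ {zero} {suc (suc j)} _ =
  ℚₚ.<-trans (0<q-p⇒p<q (W↑ zero)) (Strict⇒increasing {m} {W ∘ suc} (W↑ ∘ suc) {zero} {suc j} (s≤s z≤n))
Strict⇒increasing {suc m} {W} W↑ {suc i} {suc j} (s≤s lt) = Strict⇒increasing {m} {W ∘ suc} (W↑ ∘ suc) {i} {j} lt

-- `steps π` reads the increments of a function of values along the path `π`, and `heights π`
-- rebuilds the function with value 0 at the start of the path. They are inverse up to an additive
-- constant, which is why later statements compare gaps.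
steps : ∀ {m} → Permutation′ (suc m) → (Fin (suc m) → ℚ) → Fin m → ℚ
steps π W = gap (λ i → W (π ⟨$⟩ʳ i))

heights : ∀ {m} → Permutation′ (suc m) → (Fin m → ℚ) → Fin (suc m) → ℚ
heights π x v = Z x (π ⟨$⟩ˡ v)

steps-heights : ∀ {m} (π : Permutation′ (suc m)) x k → steps π (heights π x) k ≡ x k
steps-heights π x k = trans (cong₂ _-_ (cong (Z x) (inverseˡ π)) (cong (Z x) (inverseˡ π))) (gap-Z x k)

heights-steps : ∀ {m} (π : Permutation′ (suc m)) W v → heights π (steps π W) v ≡ W v - W (π ⟨$⟩ʳ zero)
heights-steps π W v = trans (Z-gap (λ i → W (π ⟨$⟩ʳ i)) (π ⟨$⟩ˡ v)) (cong (λ w → W w - W (π ⟨$⟩ʳ zero)) (inverseʳ π))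

Strict⇒Ord : ∀ {m} (π : Permutation′ (suc m)) W → Strict W → Ord (steps π W) π
Strict⇒Ord π W W↑ i j πi<πj =
  subst₂ _<ℚ_ (sym (Z-gap (λ i → W (π ⟨$⟩ʳ i)) i)) (sym (Z-gap (λ i → W (π ⟨$⟩ʳ i)) j))
    (ℚₚ.+-monoˡ-< (- W (π ⟨$⟩ʳ zero)) (Strict⇒increasing {W = W} W↑ πi<πj))

Ord⇒Strict : ∀ {m} (π : Permutation′ (suc m)) x → Ord x π → Strict (heights π x)
Ord⇒Strict π x ord ℓ = p<q⇒0<q-p (ord _ _
  (subst₂ _<_ (sym (trans (cong toℕ (inverseʳ π)) (toℕ-inject₁ ℓ))) (sym (cong toℕ (inverseʳ π))) ℕₚ.≤-refl))

Ord-resp : ∀ {m} (π : Permutation′ (suc m)) (x y : Fin m → ℚ) → (∀ k → x k ≡ y k) → Ord x π → Ord y π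
Ord-resp π x y x≗y ord i j lt = subst₂ _<ℚ_ (Z-cong x≗y i) (Z-cong x≗y j) (ord i j lt)

-- Equivalent permutations have the same matrix

ind : ℕ → ℕ → ℚ
ind ℓ v = if ℓ <ᵇ v then 1ℚ else 0ℚ

ind-< : ∀ {ℓ v} → ℓ < v → ind ℓ v ≡ 1ℚ
ind-< {zero} {suc v} _ = refl
ind-< {suc ℓ} {suc v} (s≤s lt) = ind-< lt

ind-≥ : ∀ {ℓ v} → v ≤ ℓ → ind ℓ v ≡ 0ℚ
ind-≥ {ℓ} {zero} _ = refl
ind-≥ {suc ℓ} {suc v} (s≤s le) = ind-≥ le

jump : ℕ → ℕ → ℕ → ℚ
jump u v ℓ = ind ℓ v - ind ℓ u

jump-values : ∀ u v ℓ → jump u v ℓ ≡ 0ℚ ⊎ jump u v ℓ ≡ 1ℚ ⊎ jump u v ℓ ≡ - 1ℚ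
jump-values u v ℓ with ℓ <ᵇ u | ℓ <ᵇ v
... | true  | true  = inj₁ refl
... | true  | false = inj₂ (inj₂ refl)
... | false | true  = inj₂ (inj₁ refl)
... | false | false = inj₁ refl

step : ∀ {m} → ℕ → Fin (suc m) → ℚ
step ℓ v = ind ℓ (toℕ v)

-- The matrix with rows ε_k 1_{S_k}.
D : ∀ {m} → Permutation′ (suc m) → Fin m → ℕ → ℚ
D π k ℓ = steps π (step ℓ) k

D-values : ∀ {m} (π : Permutation′ (suc m)) k ℓ → D π k ℓ ≡ 0ℚ ⊎ D π k ℓ ≡ 1ℚ ⊎ D π k ℓ ≡ - 1ℚ
D-values π k ℓ = jump-values (val π (inject₁ k)) (val π (suc k)) ℓ

gap-step-≡ : ∀ {m} (ℓ : Fin m) → gap (step (toℕ ℓ)) ℓ ≡ 1ℚ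
gap-step-≡ ℓ = cong₂ _-_ (ind-< {toℕ ℓ} ℕₚ.≤-refl) (ind-≥ (ℕₚ.≤-reflexive (toℕ-inject₁ ℓ)))

gap-step-≢ : ∀ {m} {ℓ a : Fin m} → ℓ ≢ a → gap (step (toℕ ℓ)) a ≡ 0ℚ
gap-step-≢ {ℓ = ℓ} {a} ℓ≢a with ℕₚ.<-cmp (toℕ ℓ) (toℕ a)
... | tri< lt _ _ = cong₂ _-_ (ind-< (ℕₚ.m<n⇒m<1+n lt)) (ind-< (subst (toℕ ℓ <_) (sym (toℕ-inject₁ a)) lt))
... | tri≈ _ eq _ = contradiction (toℕ-injective eq) ℓ≢a
... | tri> _ _ gt = cong₂ _-_ (ind-≥ gt) (ind-≥ (subst (_≤ toℕ ℓ) (sym (toℕ-inject₁ a)) (ℕₚ.<⇒≤ gt)))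

step-weak : ∀ {m} (ℓ : Fin m) → Weak (step (toℕ ℓ))
step-weak ℓ a with ℓ ≟F a
... | yes refl = subst (0ℚ ≤ℚ_) (sym (gap-step-≡ ℓ)) (ℚₚ.nonNegative⁻¹ 1ℚ)
... | no ℓ≢a = ℚₚ.≤-reflexive (sym (gap-step-≢ ℓ≢a))

gaps⇒steps : ∀ {m} (π : Permutation′ (suc m)) V W → (∀ ℓ → gap V ℓ ≡ gap W ℓ) → ∀ k → steps π V k ≡ steps π W k
gaps⇒steps π V W eq k = trans (rebase V _ _) (trans (cong₂ _-_ (agree _) (agree _)) (sym (rebase W _ _)))
  where
  rebase : ∀ U u v → U u - U v ≡ (U u - U zero) - (U v - U zero)
  rebase U u v = solve 3 (λ a b c → a :- b := (a :- c) :- (b :- c)) refl (U u) (U v) (U zero)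
  agree : ∀ v → V v - V zero ≡ W v - W zero
  agree v = trans (sym (Z-gap V v)) (trans (Z-cong eq v) (Z-gap W v))

-- The path visits every value, so its increments determine a function up to a constant. This is
-- injectivity of `D π` on gap vectors; it makes the columns nonzero and pairwise distinct.
steps⇒gaps : ∀ {m} (π : Permutation′ (suc m)) V W → (∀ k → steps π V k ≡ steps π W k) → ∀ ℓ → gap V ℓ ≡ gap W ℓ
steps⇒gaps π V W eq ℓ = trans (rebase V _ _) (trans (cong₂ _-_ (agree _) (agree _)) (sym (rebase W _ _)))
  where
  base = π ⟨$⟩ʳ zero
  rebase : ∀ U u v → U u - U v ≡ (U u - U base) - (U v - U base)
  rebase U u v = solve 3 (λ a b c → a :- b := (a :- c) :- (b :- c)) refl (U u) (U v) (U base)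
  agree : ∀ v → V v - V base ≡ W v - W base
  agree v = trans (sym (heights-steps π V v)) (trans (Z-cong eq (π ⟨$⟩ˡ v)) (heights-steps π W v))

D-column-nonzero : ∀ {m} (π : Permutation′ (suc m)) (ℓ : Fin m) → ∃ λ k → D π k (toℕ ℓ) ≢ 0ℚ
D-column-nonzero π ℓ with any? (λ k → ¬? (D π k (toℕ ℓ) ℚₚ.≟ 0ℚ))
... | yes found = found
... | no none = contradiction (trans (sym (gap-step-≡ ℓ)) (steps⇒gaps π (step (toℕ ℓ)) (λ _ → 0ℚ) zero-steps ℓ)) ℚₚ.1≢0
  where
  zero-steps : ∀ k → D π k (toℕ ℓ) ≡ 0ℚ
  zero-steps k = decidable-stable (_ ℚₚ.≟ _) (λ ≢0 → none (k , ≢0))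

D-columns-distinct : ∀ {m} (π : Permutation′ (suc m)) {ℓ a : Fin m} → (∀ k → D π k (toℕ ℓ) ≡ D π k (toℕ a)) → ℓ ≡ a
D-columns-distinct π {ℓ} {a} eq with a ≟F ℓ
... | yes a≡ℓ = sym a≡ℓ
... | no a≢ℓ = contradiction
  (trans (sym (gap-step-≡ ℓ)) (trans (steps⇒gaps π (step (toℕ ℓ)) (step (toℕ a)) eq ℓ) (gap-step-≢ a≢ℓ))) ℚₚ.1≢0

-- Monotone changes of coordinates permute the elementary steps

0<*0< : ∀ {p q} → 0ℚ <ℚ p → 0ℚ <ℚ q → 0ℚ <ℚ p * q
0<*0< {p} {q} 0<p 0<q = subst (_<ℚ p * q) (ℚₚ.*-zeroʳ p) (ℚₚ.*-monoʳ-<-pos p {{positive 0<p}} 0<q)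

0≤*0≤ : ∀ {p q} → 0ℚ ≤ℚ p → 0ℚ ≤ℚ q → 0ℚ ≤ℚ p * q
0≤*0≤ {p} {q} 0≤p 0≤q = subst (_≤ℚ p * q) (ℚₚ.*-zeroʳ p) (ℚₚ.*-monoˡ-≤-nonNeg p {{nonNegative 0≤p}} 0≤q)

0≤∧≢0⇒0< : ∀ {p} → 0ℚ ≤ℚ p → p ≢ 0ℚ → 0ℚ <ℚ p
0≤∧≢0⇒0< 0≤p p≢0 = ℚₚ.≰⇒> (λ p≤0 → p≢0 (ℚₚ.≤-antisym p≤0 0≤p))

record SameMatrix {m} (π τ : Permutation′ (suc m)) : Set where
  field
    ρ σ : Permutation′ m
    match : ∀ k (ℓ : Fin m) → D π k (toℕ ℓ) ≡ D τ (ρ ⟨$⟩ʳ k) (toℕ (σ ⟨$⟩ʳ ℓ))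

SameMatrix-sym : ∀ {m} {π τ : Permutation′ (suc m)} → SameMatrix π τ → SameMatrix τ π
SameMatrix-sym {τ = τ} S = record
  { ρ = flip ρ
  ; σ = flip σ
  ; match = λ k ℓ → trans (cong₂ (λ k ℓ → D τ k (toℕ ℓ)) (sym (inverseʳ ρ)) (sym (inverseʳ σ))) (sym (match _ _))
  } where open SameMatrix S

transfer : ∀ {m} (π τ : Permutation′ (suc m)) (ρ : Permutation′ m) → (Fin (suc m) → ℚ) → Fin (suc m) → ℚ
transfer π τ ρ W = heights τ (steps π W ∘ (ρ ⟨$⟩ʳ_))

transfer-linear : ∀ {m} (π τ : Permutation′ (suc m)) ρ c d V W ℓ →
  gap (transfer π τ ρ (λ v → c * V v +ℚ d * W v)) ℓ ≡ c * gap (transfer π τ ρ V) ℓ +ℚ d * gap (transfer π τ ρ W) ℓ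
transfer-linear π τ ρ c d V W ℓ = trans (cong₂ _-_ (pointwise (suc ℓ)) (pointwise (inject₁ ℓ)))
  (gap-linear c d (transfer π τ ρ V) (transfer π τ ρ W) ℓ)
  where
  pointwise : ∀ v → transfer π τ ρ (λ v → c * V v +ℚ d * W v) v ≡ c * transfer π τ ρ V v +ℚ d * transfer π τ ρ W v
  pointwise v = trans
    (Z-cong (λ k → gap-linear c d (λ i → V (π ⟨$⟩ʳ i)) (λ i → W (π ⟨$⟩ʳ i)) (ρ ⟨$⟩ʳ k)) (τ ⟨$⟩ˡ v))
    (Z-linear c d _ _ (τ ⟨$⟩ˡ v))

Preserving : ∀ {m} (π τ : Permutation′ (suc m)) (ρ : Permutation′ m) → Set
Preserving π τ ρ = ∀ x → Ord x π → Ord (x ∘ (ρ ⟨$⟩ʳ_)) τ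

module _ {m} (π τ : Permutation′ (suc m)) (ρ : Permutation′ m) (pres : Preserving π τ ρ) where

  transfer-strict : ∀ W → Strict W → Strict (transfer π τ ρ W)
  transfer-strict W W↑ = Ord⇒Strict τ (steps π W ∘ (ρ ⟨$⟩ʳ_)) (pres (steps π W) (Strict⇒Ord π W W↑))

  transfer-weak : ∀ W → Weak W → Weak (transfer π τ ρ W)
  transfer-weak W W↑ ℓ with gap (transfer π τ ρ W) ℓ ℚₚ.<? 0ℚ
  ... | no p≮0 = ℚₚ.≮⇒≥ p≮0
  ... | yes p<0 = contradiction (subst (0ℚ <ℚ_) cancels (transfer-strict V V↑ ℓ)) (ℚₚ.<-irrefl refl)
    where
    J V : Fin (suc m) → ℚ
    J = Z (λ _ → 1ℚ)
    p q : ℚ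
    p = gap (transfer π τ ρ W) ℓ
    q = gap (transfer π τ ρ J) ℓ
    -- This replaces a limit argument. If `p < 0`, then `V` is strictly increasing like `J`, but the
    -- coefficients are chosen so that its transfer has gap `q * p - p * q`, which is 0, at `ℓ`.
    V v = q * W v +ℚ (- p) * J v
    J↑ : Strict J
    J↑ a = subst (0ℚ <ℚ_) (sym (gap-Z _ a)) (ℚₚ.positive⁻¹ 1ℚ)
    0<-p : 0ℚ <ℚ - p
    0<-p = ℚₚ.neg-antimono-< p<0
    0<q : 0ℚ <ℚ q
    0<q = transfer-strict J J↑ ℓ
    V↑ : Strict V
    V↑ a = subst (0ℚ <ℚ_) (sym (gap-linear q (- p) W J a))
      (ℚₚ.+-mono-≤-< (0≤*0≤ (ℚₚ.<⇒≤ 0<q) (W↑ a)) (0<*0< 0<-p (J↑ a)))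
    cancels : gap (transfer π τ ρ V) ℓ ≡ 0ℚ
    cancels = trans (transfer-linear π τ ρ q (- p) W J ℓ)
      (solve 2 (λ p q → q :* p :+ (:- p) :* q := con 0ℚ) refl p q)

  -- The steps of the transfer along `τ` are, up to `ρ`, the entries of column `ℓ` of `D π`. A flat
  -- transfer would make that column zero.
  transfer-step-nonconstant : ∀ (ℓ : Fin m) → ∃ λ a → 0ℚ <ℚ gap (transfer π τ ρ (step (toℕ ℓ))) a
  transfer-step-nonconstant ℓ with any? (λ a → ¬? (gap (transfer π τ ρ (step (toℕ ℓ))) a ℚₚ.≟ 0ℚ))
  ... | yes (a , ≢0) = a , 0≤∧≢0⇒0< (transfer-weak (step (toℕ ℓ)) (step-weak ℓ) a) ≢0
  ... | no none with D-column-nonzero π ℓ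
  ...   | k , D≢0 = contradiction (begin
      D π k (toℕ ℓ)                              ≡⟨ cong (λ k → D π k (toℕ ℓ)) (sym (inverseʳ ρ)) ⟩
      D π (ρ ⟨$⟩ʳ (ρ ⟨$⟩ˡ k)) (toℕ ℓ)            ≡⟨ sym (steps-heights τ _ (ρ ⟨$⟩ˡ k)) ⟩
      steps τ (transfer π τ ρ (step (toℕ ℓ))) _
        ≡⟨ gaps⇒steps τ (transfer π τ ρ (step (toℕ ℓ))) (λ _ → 0ℚ) flat (ρ ⟨$⟩ˡ k) ⟩
      0ℚ                                         ∎) D≢0
    where
    open ≡-Reasoning
    flat : ∀ a → gap (transfer π τ ρ (step (toℕ ℓ))) a ≡ 0ℚ
    flat a = decidable-stable (_ ℚₚ.≟ _) (λ ≢0 → none (a , ≢0))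

0≰-1 : ¬ (0ℚ ≤ℚ - 1ℚ)
0≰-1 0≤-1 = ℚₚ.<-irrefl refl (ℚₚ.<-≤-trans (ℚₚ.negative⁻¹ (- 1ℚ)) 0≤-1)

-- A nonnegative ratio between two nonzero entries of absolute value 1 can only be 1.
jump-scale≡1 : ∀ {c p q} → 0ℚ ≤ℚ c → p ≢ 0ℚ → p ≡ c * q →
  p ≡ 0ℚ ⊎ p ≡ 1ℚ ⊎ p ≡ - 1ℚ → q ≡ 0ℚ ⊎ q ≡ 1ℚ ⊎ q ≡ - 1ℚ → c ≡ 1ℚ
jump-scale≡1 0≤c p≢0 eq (inj₁ p≡0) _ = contradiction p≡0 p≢0
jump-scale≡1 {c} 0≤c p≢0 eq (inj₂ _) (inj₁ refl) = contradiction (trans eq (ℚₚ.*-zeroʳ c)) p≢0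
jump-scale≡1 {c} 0≤c p≢0 eq (inj₂ (inj₁ refl)) (inj₂ (inj₁ refl)) = trans (sym (ℚₚ.*-identityʳ c)) (sym eq)
jump-scale≡1 {c} 0≤c p≢0 eq (inj₂ (inj₂ refl)) (inj₂ (inj₂ refl)) =
  trans (solve 1 (λ c → c := :- (c :* con (- 1ℚ))) refl c) (cong -_ (sym eq))
jump-scale≡1 {c} 0≤c p≢0 eq (inj₂ (inj₂ refl)) (inj₂ (inj₁ refl)) =
  contradiction (subst (0ℚ ≤ℚ_) (trans (sym (ℚₚ.*-identityʳ c)) (sym eq)) 0≤c) 0≰-1
jump-scale≡1 {c} 0≤c p≢0 eq (inj₂ (inj₁ refl)) (inj₂ (inj₂ refl)) =
  contradiction
    (subst (0ℚ ≤ℚ_) (trans (solve 1 (λ c → c := :- (c :* con (- 1ℚ))) refl c) (cong -_ (sym eq))) 0≤c) 0≰-1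

-- If transfer raises the elementary step at ℓ by some positive amount at a, then, as the inverse transfer is also
-- monotone, it sends the elementary step at a to a multiple of the one at ℓ.
column-match : ∀ {m} (π τ : Permutation′ (suc m)) ρ → Preserving π τ ρ → Preserving τ π (flip ρ) →
  ∀ (ℓ : Fin m) → ∃ λ (a : Fin m) → ∀ k → D τ k (toℕ a) ≡ D π (ρ ⟨$⟩ʳ k) (toℕ ℓ)
column-match {m} π τ ρ pres pres⁻¹ ℓ with transfer-step-nonconstant π τ ρ pres ℓ
... | a , 0<c₀ = a , λ k → trans (proportional k) (trans (cong (_* _) c≡1) (ℚₚ.*-identityˡ _))
  where
  open ≡-Reasoning
  E w h V : Fin (suc m) → ℚ
  E = step (toℕ ℓ)
  w = transfer π τ ρ E
  h = transfer τ π (flip ρ) (step (toℕ a))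
  c₀ c : ℚ
  c₀ = gap w a
  c = gap h ℓ
  -- Subtracting `c₀` times the step at `a` changes only the gap at `a`, which becomes exactly 0, so
  -- `V` stays weakly increasing.
  V v = 1ℚ * w v +ℚ (- c₀) * step (toℕ a) v

  h↑ : Weak h
  h↑ = transfer-weak τ π (flip ρ) pres⁻¹ (step (toℕ a)) (step-weak a)

  V↑ : Weak V
  V↑ b with a ≟F b
  ... | yes refl = ℚₚ.≤-reflexive (sym (trans (gap-linear 1ℚ (- c₀) w (step (toℕ a)) a)
    (trans (cong (λ z → 1ℚ * c₀ +ℚ (- c₀) * z) (gap-step-≡ a))
      (solve 1 (λ c → con 1ℚ :* c :+ (:- c) :* con 1ℚ := con 0ℚ) refl c₀))))
  ... | no a≢b = subst (0ℚ ≤ℚ_) (sym (trans (gap-linear 1ℚ (- c₀) w (step (toℕ a)) b)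
    (trans (cong (λ z → 1ℚ * gap w b +ℚ (- c₀) * z) (gap-step-≢ a≢b))
      (solve 2 (λ c d → con 1ℚ :* d :+ (:- c) :* con 0ℚ := d) refl c₀ (gap w b)))))
    (transfer-weak π τ ρ pres E (step-weak ℓ) b)

  gap-w⁻¹ : ∀ b → gap (transfer τ π (flip ρ) w) b ≡ gap E b
  gap-w⁻¹ = steps⇒gaps π (transfer τ π (flip ρ) w) E (λ k →
    trans (steps-heights π _ k) (trans (steps-heights τ _ (ρ ⟨$⟩ˡ k))
    (cong (steps π E) (inverseʳ ρ))))

  -- The inverse transfer takes `w` back to `E` up to a constant, so away from `ℓ` the image of `V`
  -- has gap `- (c₀ * gap h b)`. This is nonnegative while `c₀` is positive, so `gap h b` cannot be
  -- positive.
  gap-h-≢ : ∀ b → ℓ ≢ b → gap h b ≡ 0ℚ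
  gap-h-≢ b ℓ≢b with 0ℚ ℚₚ.<? gap h b
  ... | no ≮ = ℚₚ.≤-antisym (ℚₚ.≮⇒≥ ≮) (h↑ b)
  ... | yes 0<g = contradiction
    (ℚₚ.<-≤-trans (ℚₚ.neg-antimono-< (0<*0< 0<c₀ 0<g))
      (subst (0ℚ ≤ℚ_) eq (transfer-weak τ π (flip ρ) pres⁻¹ V V↑ b))) (ℚₚ.<-irrefl refl)
    where
    eq : gap (transfer τ π (flip ρ) V) b ≡ - (c₀ * gap h b)
    eq = trans (transfer-linear τ π (flip ρ) 1ℚ (- c₀) w (step (toℕ a)) b)
      (trans (cong (λ z → 1ℚ * z +ℚ (- c₀) * gap h b) (trans (gap-w⁻¹ b) (gap-step-≢ ℓ≢b)))
        (solve 2 (λ c d → con 1ℚ :* con 0ℚ :+ (:- c) :* d := :- (c :* d)) refl c₀ (gap h b)))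

  gap-h : ∀ b → gap h b ≡ gap (λ v → c * E v +ℚ 0ℚ * E v) b
  gap-h b = trans (diag b) (sym (trans (gap-linear c 0ℚ E E b)
      (solve 2 (λ c d → c :* d :+ con 0ℚ :* d := c :* d) refl c (gap E b))))
    where
    diag : ∀ b → gap h b ≡ c * gap E b
    diag b with ℓ ≟F b
    ... | yes refl = sym (trans (cong (c *_) (gap-step-≡ ℓ)) (ℚₚ.*-identityʳ c))
    ... | no ℓ≢b = trans (gap-h-≢ b ℓ≢b) (sym (trans (cong (c *_) (gap-step-≢ ℓ≢b)) (ℚₚ.*-zeroʳ c)))

  proportional : ∀ k → D τ k (toℕ a) ≡ c * D π (ρ ⟨$⟩ʳ k) (toℕ ℓ)
  proportional k = begin
    D τ k (toℕ a)                                          ≡⟨ cong (λ k → D τ k (toℕ a)) (sym (inverseˡ ρ)) ⟩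
    D τ (ρ ⟨$⟩ˡ (ρ ⟨$⟩ʳ k)) (toℕ a)                        ≡⟨ sym (steps-heights π _ (ρ ⟨$⟩ʳ k)) ⟩
    steps π h (ρ ⟨$⟩ʳ k)
      ≡⟨ gaps⇒steps π h (λ v → c * E v +ℚ 0ℚ * E v) gap-h (ρ ⟨$⟩ʳ k) ⟩
    steps π (λ v → c * E v +ℚ 0ℚ * E v) (ρ ⟨$⟩ʳ k)
      ≡⟨ gap-linear c 0ℚ (λ i → E (π ⟨$⟩ʳ i)) (λ i → E (π ⟨$⟩ʳ i)) (ρ ⟨$⟩ʳ k) ⟩
    c * D π (ρ ⟨$⟩ʳ k) (toℕ ℓ) +ℚ 0ℚ * D π (ρ ⟨$⟩ʳ k) (toℕ ℓ)
      ≡⟨ solve 2 (λ c d → c :* d :+ con 0ℚ :* d := c :* d) refl c (D π (ρ ⟨$⟩ʳ k) (toℕ ℓ)) ⟩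
    c * D π (ρ ⟨$⟩ʳ k) (toℕ ℓ)                             ∎

  c≡1 : c ≡ 1ℚ
  c≡1 with D-column-nonzero τ a
  ... | k , D≢0 = jump-scale≡1 (h↑ ℓ) D≢0 (proportional k) (D-values τ k (toℕ a)) (D-values π (ρ ⟨$⟩ʳ k) (toℕ ℓ))

∼⇒SameMatrix : ∀ {m} {π τ : Permutation′ (suc m)} → π ∼ τ → SameMatrix π τ
∼⇒SameMatrix {m} {π} {τ} (ρ , equiv) = record
  { ρ = flip ρ
  -- Passing to the other permutation and back yields a level with the same column, and columns are
  -- pairwise distinct.
  ; σ = permutation to from
      (λ a → D-columns-distinct τ (λ k → trans (to-match (from a) k)
        (trans (from-match a _) (cong (λ k → D τ k (toℕ a)) (inverseˡ ρ)))))
      (λ ℓ → D-columns-distinct π (λ k → trans (from-match (to ℓ) k)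
        (trans (to-match ℓ _) (cong (λ k → D π k (toℕ ℓ)) (inverseʳ ρ)))))
  ; match = λ k ℓ → trans (cong (λ k → D π k (toℕ ℓ)) (sym (inverseʳ ρ))) (sym (to-match ℓ _))
  }
  where
  pres : Preserving π τ ρ
  pres x ord = PEq⇒Ord _ τ (Equivalence.to (equiv x) (Ord⇒PEq x π ord))
  pres⁻¹ : Preserving τ π (flip ρ)
  pres⁻¹ x ord = PEq⇒Ord _ π
    (Equivalence.from (equiv (x ∘ (ρ ⟨$⟩ˡ_))) (Ord⇒PEq _ τ (Ord-resp τ x _ (λ k → cong x (sym (inverseˡ ρ))) ord)))
  to from : Fin m → Fin m
  to ℓ = proj₁ (column-match π τ ρ pres pres⁻¹ ℓ)
  from a = proj₁ (column-match τ π (flip ρ) pres⁻¹ pres a)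
  to-match : ∀ ℓ k → D τ k (toℕ (to ℓ)) ≡ D π (ρ ⟨$⟩ʳ k) (toℕ ℓ)
  to-match ℓ = proj₂ (column-match π τ ρ pres pres⁻¹ ℓ)
  from-match : ∀ a k → D π k (toℕ (from a)) ≡ D τ (ρ ⟨$⟩ˡ k) (toℕ a)
  from-match a = proj₂ (column-match τ π (flip ρ) pres⁻¹ pres a)

-- Permutations with the same matrix are equivalent

sum-step-gap : ∀ {m} (W : Fin (suc m) → ℚ) v → Σℚ.sum (λ ℓ → step (toℕ ℓ) v * gap W ℓ) ≡ W v - W zero
sum-step-gap {zero} W zero = sym (ℚₚ.+-inverseʳ (W zero))
sum-step-gap {suc m} W zero = trans (cong₂ _+ℚ_ (ℚₚ.*-zeroˡ (gap W zero)) (sum-step-gap (W ∘ suc) zero))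
  (solve 2 (λ a b → con 0ℚ :+ (a :- a) := b :- b) refl (W (suc zero)) (W zero))
sum-step-gap {suc m} W (suc v) = trans (cong (1ℚ * gap W zero +ℚ_) (sum-step-gap (W ∘ suc) v))
  (solve 3 (λ a b c → con 1ℚ :* (b :- a) :+ (c :- b) := c :- a) refl (W zero) (W (suc zero)) (W (suc v)))

sum-difference : ∀ {m} (f g y : Fin m → ℚ) →
  Σℚ.sum (λ ℓ → f ℓ * y ℓ) - Σℚ.sum (λ ℓ → g ℓ * y ℓ) ≡ Σℚ.sum (λ ℓ → (f ℓ - g ℓ) * y ℓ)
sum-difference {zero} f g y = refl
sum-difference {suc m} f g y = trans
  (solve 5 (λ f g y a b → (f :* y :+ a) :- (g :* y :+ b) := (f :- g) :* y :+ (a :- b)) refl (f zero) (g zero) (y zero)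
    (Σℚ.sum (λ ℓ → f (suc ℓ) * y (suc ℓ))) (Σℚ.sum (λ ℓ → g (suc ℓ) * y (suc ℓ))))
  (cong ((f zero - g zero) * y zero +ℚ_) (sum-difference (f ∘ suc) (g ∘ suc) (y ∘ suc)))

-- With `u` and `v` the two ends of an edge, this says that `steps π W` is the matrix `D π` applied
-- to the gap vector of `W`.
sum-jump-gap : ∀ {m} (W : Fin (suc m) → ℚ) u v → Σℚ.sum (λ ℓ → (step (toℕ ℓ) v - step (toℕ ℓ) u) * gap W ℓ) ≡ W v - W u
sum-jump-gap W u v = trans (sym (sum-difference (λ ℓ → step (toℕ ℓ) v) (λ ℓ → step (toℕ ℓ) u) (gap W)))
  (trans (cong₂ _-_ (sum-step-gap W v) (sum-step-gap W u))
    (solve 3 (λ a b c → (a :- c) :- (b :- c) := a :- b) refl (W v) (W u) (W zero)))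

sum-nonneg : ∀ {m} {f : Fin m → ℚ} → (∀ i → 0ℚ ≤ℚ f i) → 0ℚ ≤ℚ Σℚ.sum f
sum-nonneg {zero} _ = ℚₚ.≤-refl
sum-nonneg {suc m} f≥0 = ℚₚ.+-mono-≤ (f≥0 zero) (sum-nonneg (f≥0 ∘ suc))

sum-pos : ∀ {m} {f : Fin m → ℚ} → (∀ i → 0ℚ ≤ℚ f i) → ∀ i → 0ℚ <ℚ f i → 0ℚ <ℚ Σℚ.sum f
sum-pos f≥0 zero fi>0 = ℚₚ.+-mono-<-≤ fi>0 (sum-nonneg (f≥0 ∘ suc))
sum-pos f≥0 (suc i) fi>0 = ℚₚ.+-mono-≤-< (f≥0 zero) (sum-pos (f≥0 ∘ suc) i fi>0)

SameMatrix⇒Ord : ∀ {m} {π τ : Permutation′ (suc m)} (S : SameMatrix π τ) →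
  Preserving π τ (flip (SameMatrix.ρ S))
SameMatrix⇒Ord {m} {π} {τ} S x ord = Ord-resp τ (steps τ W′) (x ∘ (ρ ⟨$⟩ˡ_)) recovers (Strict⇒Ord τ W′ W′↑)
  where
  open SameMatrix S
  open ≡-Reasoning
  W W′ : Fin (suc m) → ℚ
  W = heights π x
  -- `W′` starts at 0 and its gap at `σ ℓ` is the gap of `W` at `ℓ`. Equality of the matrices then
  -- makes its steps along `τ` the entries of `x` permuted by the inverse of `ρ`.
  W′ v = Σℚ.sum (λ ℓ → step (toℕ (σ ⟨$⟩ʳ ℓ)) v * gap W ℓ)

  W↑ : Strict W
  W↑ = Ord⇒Strict π x ord

  W′-difference : ∀ u v → W′ v - W′ u ≡
    Σℚ.sum (λ ℓ → (step (toℕ (σ ⟨$⟩ʳ ℓ)) v - step (toℕ (σ ⟨$⟩ʳ ℓ)) u) * gap W ℓ)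
  W′-difference u v = sum-difference (λ ℓ → step (toℕ (σ ⟨$⟩ʳ ℓ)) v) (λ ℓ → step (toℕ (σ ⟨$⟩ʳ ℓ)) u) (gap W)

  W′↑ : Strict W′
  W′↑ a = subst (0ℚ <ℚ_) (sym (W′-difference (inject₁ a) (suc a)))
    (sum-pos (λ ℓ → 0≤*0≤ (step-weak (σ ⟨$⟩ʳ ℓ) a) (ℚₚ.<⇒≤ (W↑ ℓ))) (σ ⟨$⟩ˡ a)
      (subst (λ b → 0ℚ <ℚ gap (step (toℕ b)) a * gap W (σ ⟨$⟩ˡ a)) (sym (inverseʳ σ))
        (subst (λ z → 0ℚ <ℚ z * gap W (σ ⟨$⟩ˡ a)) (sym (gap-step-≡ a)) (0<*0< (ℚₚ.positive⁻¹ 1ℚ) (W↑ (σ ⟨$⟩ˡ a))))))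

  match⁻¹ : ∀ k ℓ → D τ k (toℕ (σ ⟨$⟩ʳ ℓ)) ≡ D π (ρ ⟨$⟩ˡ k) (toℕ ℓ)
  match⁻¹ k ℓ = trans (cong (λ k → D τ k (toℕ (σ ⟨$⟩ʳ ℓ))) (sym (inverseʳ ρ))) (sym (match (ρ ⟨$⟩ˡ k) ℓ))

  recovers : ∀ k → steps τ W′ k ≡ x (ρ ⟨$⟩ˡ k)
  recovers k = begin
    steps τ W′ k
      ≡⟨ W′-difference (τ ⟨$⟩ʳ inject₁ k) (τ ⟨$⟩ʳ suc k) ⟩
    Σℚ.sum (λ ℓ → D τ k (toℕ (σ ⟨$⟩ʳ ℓ)) * gap W ℓ)
      ≡⟨ Σℚ.sum-cong-≗ (λ ℓ → cong (_* gap W ℓ) (match⁻¹ k ℓ)) ⟩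
    Σℚ.sum (λ ℓ → D π (ρ ⟨$⟩ˡ k) (toℕ ℓ) * gap W ℓ)
      ≡⟨ sum-jump-gap W (π ⟨$⟩ʳ inject₁ (ρ ⟨$⟩ˡ k)) (π ⟨$⟩ʳ suc (ρ ⟨$⟩ˡ k)) ⟩
    steps π W (ρ ⟨$⟩ˡ k)
      ≡⟨ steps-heights π x (ρ ⟨$⟩ˡ k) ⟩
    x (ρ ⟨$⟩ˡ k) ∎

SameMatrix⇒∼ : ∀ {m} {π τ : Permutation′ (suc m)} → SameMatrix π τ → π ∼ τ
SameMatrix⇒∼ {m} {π} {τ} S = flip ρ , λ x → mk⇔
  (λ p → Ord⇒PEq _ τ (SameMatrix⇒Ord S x (PEq⇒Ord x π p)))
  (λ q → Ord⇒PEq x π (Ord-resp π _ x (λ k → cong x (inverseˡ ρ))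
    (SameMatrix⇒Ord (SameMatrix-sym S) (x ∘ (ρ ⟨$⟩ˡ_)) (PEq⇒Ord _ τ q))))
  where open SameMatrix S

∼-refl : ∀ {m} {π : Permutation′ (suc m)} → π ∼ π
∼-refl = Permutation.id , λ x → mk⇔ id id

∼-trans : ∀ {m} {π τ υ : Permutation′ (suc m)} → π ∼ τ → τ ∼ υ → π ∼ υ
∼-trans (ρ₁ , e₁) (ρ₂ , e₂) = ρ₂ Permutation.∘ₚ ρ₁ , λ x → mk⇔
  (λ p → Equivalence.to (e₂ (x ∘ (ρ₁ ⟨$⟩ʳ_))) (Equivalence.to (e₁ x) p))
  (λ q → Equivalence.from (e₁ x) (Equivalence.from (e₂ (x ∘ (ρ₁ ⟨$⟩ʳ_))) q))

-- Permutations and flips as bijections of ℕ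

-- Bijections of all of ℕ that preserve the segment below `n` allow positions and values to be
-- reflected by plain arithmetic, without casts between `Fin` types.
record Bij (n : ℕ) : Set where
  field
    to from : ℕ → ℕ
    from-to : ∀ i → from (to i) ≡ i
    to-from : ∀ i → to (from i) ≡ i
    to< : ∀ {i} → i < n → to i < n
    from< : ∀ {i} → i < n → from i < n

  to-injective : ∀ {i j} → to i ≡ to j → i ≡ j
  to-injective eq = trans (sym (from-to _)) (trans (cong from eq) (from-to _))

open Bij using (to; from)

_∘ᵇ_ : ∀ {n} → Bij n → Bij n → Bij n
g ∘ᵇ f = record
  { to = λ i → G.to (F.to i)
  ; from = λ i → F.from (G.from i)
  ; from-to = λ i → trans (cong F.from (G.from-to (F.to i))) (F.from-to i)
  ; to-from = λ i → trans (cong G.to (F.to-from (G.from i))) (G.to-from i)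
  ; to< = λ lt → G.to< (F.to< lt)
  ; from< = λ lt → F.from< (G.from< lt)
  } where
  module F = Bij f
  module G = Bij g

toPerm : ∀ {n} → Bij n → Permutation′ n
toPerm {n} f = permutation
  (λ i → fromℕ< (F.to< (toℕ<n i)))
  (λ i → fromℕ< (F.from< (toℕ<n i)))
  (λ i → toℕ-injective (trans (toℕ-fromℕ< _) (trans (cong F.to (toℕ-fromℕ< _)) (F.to-from (toℕ i)))))
  (λ i → toℕ-injective (trans (toℕ-fromℕ< _) (trans (cong F.from (toℕ-fromℕ< _)) (F.from-to (toℕ i)))))
  where module F = Bij f

toℕ-toPerm : ∀ {n} (f : Bij n) i → toℕ (toPerm f ⟨$⟩ʳ i) ≡ to f (toℕ i)
toℕ-toPerm f i = toℕ-fromℕ< _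

extend : ∀ {n} → Permutation′ n → ℕ → ℕ
extend {n} π i with i <? n
... | yes i<n = toℕ (π ⟨$⟩ʳ fromℕ< i<n)
... | no _ = i

extend-toℕ : ∀ {n} (π : Permutation′ n) i → extend π (toℕ i) ≡ toℕ (π ⟨$⟩ʳ i)
extend-toℕ {n} π i with toℕ i <? n
... | yes i<n = cong (λ j → toℕ (π ⟨$⟩ʳ j)) (fromℕ<-toℕ i i<n)
... | no i≮n = contradiction (toℕ<n i) i≮n

extend-≮ : ∀ {n} (π : Permutation′ n) {i} → ¬ (i < n) → extend π i ≡ i
extend-≮ {n} π {i} i≮n with i <? n
... | yes i<n = contradiction i<n i≮n
... | no _ = refl

extend-< : ∀ {n} (π : Permutation′ n) {i} (i<n : i < n) → extend π i ≡ toℕ (π ⟨$⟩ʳ fromℕ< i<n)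
extend-< π i<n = trans (cong (extend π) (sym (toℕ-fromℕ< i<n))) (extend-toℕ π _)

extend-flip : ∀ {n} (π : Permutation′ n) i → extend (flip π) (extend π i) ≡ i
extend-flip {n} π i = by-cases (i <? n)
  where
  by-cases : Dec (i < n) → extend (flip π) (extend π i) ≡ i
  by-cases (yes i<n) = trans (cong (extend (flip π)) (extend-< π i<n))
    (trans (extend-toℕ (flip π) _) (trans (cong toℕ (inverseˡ π)) (toℕ-fromℕ< i<n)))
  by-cases (no i≮n) = trans (cong (extend (flip π)) (extend-≮ π i≮n)) (extend-≮ (flip π) i≮n)

fromPerm : ∀ {n} → Permutation′ n → Bij n
fromPerm π = record
  { to = extend π
  ; from = extend (flip π)
  ; from-to = extend-flip π
  ; to-from = extend-flip (flip π)
  ; to< = λ lt → subst (_< _) (sym (extend-< π lt)) (toℕ<n _)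
  ; from< = λ lt → subst (_< _) (sym (extend-< (flip π) lt)) (toℕ<n _)
  }

-- Arithmetic of reflections

flipFun-in : ∀ {a b i} → a ≤ i → i < b → flipFun a b i ≡ (a + b) ∸ suc i
flipFun-in {a} {b} {i} a≤i i<b with a ≤ᵇ i | ℕₚ.≤⇒≤ᵇ a≤i | i <ᵇ b | ℕₚ.<⇒<ᵇ i<b
... | true | _ | true | _ = refl

flipFun-out : ∀ {a b i} → ¬ (a ≤ i × i < b) → flipFun a b i ≡ i
flipFun-out {a} {b} {i} out with a ≤ᵇ i in eq₁ | i <ᵇ b in eq₂
... | false | _ = refl
... | true | false = refl
... | true | true = contradiction (ℕₚ.≤ᵇ⇒≤ a i (subst T (sym eq₁) _) , ℕₚ.<ᵇ⇒< i b (subst T (sym eq₂) _)) out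

-- The additive form avoids truncated subtraction; by cancellation it characterizes the image, as
-- `flipFun-≡` records.
flipFun-sum : ∀ {a b i} → a ≤ i → i < b → suc (i + flipFun a b i) ≡ a + b
flipFun-sum {a} {b} {i} a≤i i<b = trans (cong (suc i +_) (flipFun-in a≤i i<b))
  (ℕₚ.m+[n∸m]≡n (ℕₚ.≤-trans i<b (ℕₚ.m≤n+m b a)))

flipFun-≡ : ∀ {a b i j} → a ≤ i → i < b → suc (i + j) ≡ a + b → flipFun a b i ≡ j
flipFun-≡ {a} {b} {i} a≤i i<b eq = ℕₚ.+-cancelˡ-≡ (suc i) _ _ (trans (flipFun-sum a≤i i<b) (sym eq))

reflect-≥ : ∀ {a b i j} → suc (i + j) ≡ a + b → i < b → a ≤ j
reflect-≥ {a} {b} {i} {j} eq i<b = ℕₚ.+-cancelˡ-≤ b a j (begin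
  b + a ≡⟨ ℕₚ.+-comm b a ⟩
  a + b ≡⟨ sym eq ⟩
  suc i + j ≤⟨ ℕₚ.+-monoˡ-≤ j i<b ⟩
  b + j ∎)
  where open ℕₚ.≤-Reasoning

reflect-< : ∀ {a b i j} → suc (i + j) ≡ a + b → a ≤ i → j < b
reflect-< {a} {b} {i} {j} eq a≤i = ℕₚ.+-cancelˡ-< a j b (begin
  suc (a + j) ≤⟨ s≤s (ℕₚ.+-monoˡ-≤ j a≤i) ⟩
  suc (i + j) ≡⟨ eq ⟩
  a + b ∎)
  where open ℕₚ.≤-Reasoning

flipFun-≥ : ∀ {a b i} → a ≤ i → i < b → a ≤ flipFun a b i
flipFun-≥ a≤i i<b = reflect-≥ (flipFun-sum a≤i i<b) i<b

flipFun-< : ∀ {a b i} → a ≤ i → i < b → flipFun a b i < b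
flipFun-< a≤i i<b = reflect-< (flipFun-sum a≤i i<b) a≤i

flipFun-involutive : ∀ a b i → flipFun a b (flipFun a b i) ≡ i
flipFun-involutive a b i = by-cases ((a ≤? i) ×-dec (i <? b))
  where
  by-cases : Dec (a ≤ i × i < b) → flipFun a b (flipFun a b i) ≡ i
  by-cases (yes (a≤i , i<b)) = flipFun-≡ (flipFun-≥ a≤i i<b) (flipFun-< a≤i i<b)
    (trans (cong suc (ℕₚ.+-comm _ i)) (flipFun-sum a≤i i<b))
  by-cases (no out) = trans (cong (flipFun a b) (flipFun-out out)) (flipFun-out out)

flipFun-bound : ∀ {n} a {b} → b ≤ n → ∀ {i} → i < n → flipFun a b i < n
flipFun-bound {n} a {b} b≤n {i} i<n = by-cases ((a ≤? i) ×-dec (i <? b))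
  where
  by-cases : Dec (a ≤ i × i < b) → flipFun a b i < n
  by-cases (yes (a≤i , i<b)) = ℕₚ.<-≤-trans (flipFun-< a≤i i<b) b≤n
  by-cases (no out) = subst (_< n) (sym (flipFun-out out)) i<n

flipBij : ∀ {n} a b → b ≤ n → Bij n
flipBij a b b≤n = record
  { to = flipFun a b
  ; from = flipFun a b
  ; from-to = flipFun-involutive a b
  ; to-from = flipFun-involutive a b
  ; to< = flipFun-bound a b≤n
  ; from< = flipFun-bound a b≤n
  }

-- Flip steps preserve the matrix

Λ? : ∀ u v ℓ → Dec (Λ u v ℓ)
Λ? u v ℓ = (u ≤? ℓ) ×-dec (ℓ <? v)

sgn : ℕ → ℕ → Sign
sgn u v = if u <ᵇ v then Sign.+ else Sign.-

weight : Sign → ℚ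
weight Sign.+ = 1ℚ
weight Sign.- = - 1ℚ

weight-injective : ∀ {s t} → weight s ≡ weight t → s ≡ t
weight-injective {Sign.+} {Sign.+} _ = refl
weight-injective {Sign.-} {Sign.-} _ = refl

weight≢0 : ∀ s → weight s ≢ 0ℚ
weight≢0 Sign.+ ()
weight≢0 Sign.- ()

sgn-< : ∀ {u v} → u < v → sgn u v ≡ Sign.+
sgn-< {zero} {suc v} _ = refl
sgn-< {suc u} {suc v} (s≤s lt) = sgn-< lt

sgn-≥ : ∀ {u v} → v ≤ u → sgn u v ≡ Sign.-
sgn-≥ {u} {zero} _ = refl
sgn-≥ {suc u} {suc v} (s≤s le) = sgn-≥ le

jump-∈ : ∀ u v {ℓ} → Λ (u ⊓ v) (u ⊔ v) ℓ → jump u v ℓ ≡ weight (sgn u v)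
jump-∈ u v {ℓ} (lo , hi) with ℕₚ.≤-total u v
... | inj₂ v≤u = trans
  (cong₂ _-_ (ind-≥ (subst (_≤ ℓ) (ℕₚ.m≥n⇒m⊓n≡n v≤u) lo)) (ind-< (subst (ℓ <_) (ℕₚ.m≥n⇒m⊔n≡m v≤u) hi)))
  (cong weight (sym (sgn-≥ v≤u)))

... | inj₁ u≤v = trans (cong₂ _-_ (ind-< ℓ<v) (ind-≥ u≤ℓ)) (cong weight (sym (sgn-< (ℕₚ.≤-<-trans u≤ℓ ℓ<v))))
  where
  u≤ℓ = subst (_≤ ℓ) (ℕₚ.m≤n⇒m⊓n≡m u≤v) lo
  ℓ<v = subst (ℓ <_) (ℕₚ.m≤n⇒m⊔n≡n u≤v) hi

jump-∉ : ∀ u v {ℓ} → ¬ Λ (u ⊓ v) (u ⊔ v) ℓ → jump u v ℓ ≡ 0ℚ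
jump-∉ u v {ℓ} out with ℓ <? u | ℓ <? v
... | yes ℓ<u | yes ℓ<v = cong₂ _-_ (ind-< ℓ<v) (ind-< ℓ<u)
... | yes ℓ<u | no ℓ≮v = contradiction
  (ℕₚ.≤-trans (ℕₚ.m⊓n≤n u v) (ℕₚ.≮⇒≥ ℓ≮v) , ℕₚ.<-≤-trans ℓ<u (ℕₚ.m≤m⊔n u v)) out
... | no ℓ≮u | yes ℓ<v = contradiction
  (ℕₚ.≤-trans (ℕₚ.m⊓n≤m u v) (ℕₚ.≮⇒≥ ℓ≮u) , ℕₚ.<-≤-trans ℓ<v (ℕₚ.m≤n⊔m u v)) out
... | no ℓ≮u | no ℓ≮v = cong₂ _-_ (ind-≥ (ℕₚ.≮⇒≥ ℓ≮v)) (ind-≥ (ℕₚ.≮⇒≥ ℓ≮u))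

jump≢0⇒∈ : ∀ u v {ℓ} → jump u v ℓ ≢ 0ℚ → Λ (u ⊓ v) (u ⊔ v) ℓ
jump≢0⇒∈ u v ≢0 = decidable-stable (Λ? _ _ _) (λ out → ≢0 (jump-∉ u v out))

∈⇒jump≢0 : ∀ u v {ℓ} → Λ (u ⊓ v) (u ⊔ v) ℓ → jump u v ℓ ≢ 0ℚ
∈⇒jump≢0 u v ∈ ≡0 = weight≢0 (sgn u v) (trans (sym (jump-∈ u v ∈)) ≡0)

val-inject₁≢val-suc : ∀ {m} (π : Permutation′ (suc m)) k → val π (inject₁ k) ≢ val π (suc k)
val-inject₁≢val-suc π k eq =
  ℕₚ.<⇒≢ (s≤s (ℕₚ.≤-reflexive (toℕ-inject₁ k))) (cong toℕ (val-injective π eq))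

val≤ : ∀ {m} (π : Permutation′ (suc m)) i → val π i ≤ m
val≤ π i = ℕₚ.≤-pred (toℕ<n (π ⟨$⟩ʳ i))

⊓∈Λ : ∀ {u v} → u ≢ v → Λ (u ⊓ v) (u ⊔ v) (u ⊓ v)
⊓∈Λ {u} {v} u≢v = ℕₚ.≤-refl , by-cases (ℕₚ.<-cmp u v)
  where

  by-cases : Tri (u < v) (u ≡ v) (v < u) → u ⊓ v < u ⊔ v
  by-cases (tri< u<v _ _) = ℕₚ.≤-<-trans (ℕₚ.m⊓n≤m u v) (ℕₚ.<-≤-trans u<v (ℕₚ.m≤n⊔m u v))
  by-cases (tri≈ _ u≡v _) = contradiction u≡v u≢v
  by-cases (tri> _ _ v<u) = ℕₚ.≤-<-trans (ℕₚ.m⊓n≤n u v) (ℕₚ.<-≤-trans v<u (ℕₚ.m≤m⊔n u v))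

jump-sgn : ∀ {u v u′ v′} ℓ → Λ (u ⊓ v) (u ⊔ v) ℓ → ∀ ℓ′ → jump u v ℓ ≡ jump u′ v′ ℓ′ → sgn u v ≡ sgn u′ v′
jump-sgn {u} {v} {u′} {v′} ℓ ∈ ℓ′ eq = weight-injective (trans (sym (jump-∈ u v ∈)) (trans eq (jump-∈ u′ v′
  (jump≢0⇒∈ u′ v′ (λ ≡0 → ∈⇒jump≢0 u v ∈ (trans eq ≡0))))))

-- The support of the jump gives the smaller endpoint, and its sign tells whether that is `u` or
-- `v`. Agreement at one end already identifies a row, since `π` is injective.
jump-determines : ∀ {u v u′ v′} → u ≢ v → u′ ≢ v′ → (∀ ℓ → jump u v ℓ ≡ jump u′ v′ ℓ) → u ≡ u′ ⊎ v ≡ v′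
jump-determines {u} {v} {u′} {v′} u≢v u′≢v′ eq = by-cases (u <? v) (u′ <? v′)
  where
  same-sgn : sgn u v ≡ sgn u′ v′
  same-sgn = jump-sgn {u} {v} {u′} {v′} (u ⊓ v) (⊓∈Λ u≢v) (u ⊓ v) (eq _)
  same-min : u ⊓ v ≡ u′ ⊓ v′
  same-min = ℕₚ.≤-antisym
    (proj₁ (jump≢0⇒∈ u v (λ ≡0 → ∈⇒jump≢0 u′ v′ (⊓∈Λ u′≢v′) (trans (sym (eq _)) ≡0))))
    (proj₁ (jump≢0⇒∈ u′ v′ (λ ≡0 → ∈⇒jump≢0 u v (⊓∈Λ u≢v) (trans (eq _) ≡0))))
  by-cases : Dec (u < v) → Dec (u′ < v′) → u ≡ u′ ⊎ v ≡ v′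
  by-cases (yes u<v) (yes u′<v′) = inj₁ (trans (sym (ℕₚ.m≤n⇒m⊓n≡m (ℕₚ.<⇒≤ u<v)))
    (trans same-min (ℕₚ.m≤n⇒m⊓n≡m (ℕₚ.<⇒≤ u′<v′))))
  by-cases (no u≮v) (no u′≮v′) = inj₂ (trans (sym (ℕₚ.m≥n⇒m⊓n≡n (ℕₚ.≮⇒≥ u≮v)))
    (trans same-min (ℕₚ.m≥n⇒m⊓n≡n (ℕₚ.≮⇒≥ u′≮v′))))
  by-cases (yes u<v) (no u′≮v′) =
    contradiction (trans (sym (sgn-< u<v)) (trans same-sgn (sgn-≥ (ℕₚ.≮⇒≥ u′≮v′)))) (λ ())
  by-cases (no u≮v) (yes u′<v′) =
    contradiction (trans (sym (sgn-≥ (ℕₚ.≮⇒≥ u≮v))) (trans same-sgn (sgn-< u′<v′))) (λ ())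

D-rows-distinct : ∀ {m} (π : Permutation′ (suc m)) {k k′} → (∀ ℓ → D π k ℓ ≡ D π k′ ℓ) → k ≡ k′
D-rows-distinct π {k} {k′} eq
  with jump-determines (val-inject₁≢val-suc π k) (val-inject₁≢val-suc π k′) eq
... | inj₁ same-start = toℕ-injective (trans (sym (toℕ-inject₁ k))
  (trans (cong toℕ (val-injective π same-start)) (toℕ-inject₁ k′)))
... | inj₂ same-end = toℕ-injective (ℕₚ.suc-injective (cong toℕ (val-injective π same-end)))

module _ {m} (π τ : Permutation′ (suc m)) (a b : ℕ) where

  private
    φ : ℕ → ℕ
    φ = flipFun a b

  pair⇒row : ∀ {k k′} → image φ (Sπ π k) ≐ Sπ τ k′ → επ π k ≡ επ τ k′ → ∀ ℓ → D π k ℓ ≡ D τ k′ (φ ℓ)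
  pair⇒row {k} {k′} same-set same-sign ℓ = by-cases (Λ? _ _ ℓ)
    where
    by-cases : Dec (Sπ π k ℓ) → D π k ℓ ≡ D τ k′ (φ ℓ)
    by-cases (yes ∈) = trans (jump-∈ (val π (inject₁ k)) (val π (suc k)) ∈) (trans (cong weight same-sign)
      (sym (jump-∈ (val τ (inject₁ k′)) (val τ (suc k′)) (proj₁ (same-set (φ ℓ)) (ℓ , ∈ , refl)))))
    by-cases (no ∉) = trans (jump-∉ (val π (inject₁ k)) (val π (suc k)) ∉)
      (sym (jump-∉ (val τ (inject₁ k′)) (val τ (suc k′)) φℓ∉))
      where
      φℓ∉ : ¬ Sπ τ k′ (φ ℓ)
      φℓ∉ φℓ∈ with proj₂ (same-set (φ ℓ)) φℓ∈
      ... | x , x∈ , φx≡φℓ = ∉ (subst (Sπ π k)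
        (trans (sym (flipFun-involutive a b x)) (trans (cong φ φx≡φℓ) (flipFun-involutive a b ℓ))) x∈)

  -- The support of a row gives the set, and the sign is read off at the smallest level. Levels
  -- below `m` suffice: both sets lie there, and `φ` preserves this range because `b ≤ m`.
  row⇒pair : b ≤ m → ∀ {k k′} → (∀ {ℓ} → ℓ < m → D π k ℓ ≡ D τ k′ (φ ℓ)) →
    image φ (Sπ π k) ≐ Sπ τ k′ × επ π k ≡ επ τ k′
  row⇒pair b≤m {k} {k′} row = (λ y → image⊆ y , ⊆image y) ,
    jump-sgn {u} {v} {u′} {v′} (u ⊓ v) min∈ _ (row (∈⇒<m π k min∈))
    where
    u v u′ v′ : ℕ
    u = val π (inject₁ k)
    v = val π (suc k)
    u′ = val τ (inject₁ k′)
    v′ = val τ (suc k′)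
    min∈ : Sπ π k (u ⊓ v)
    min∈ = ⊓∈Λ (val-inject₁≢val-suc π k)
    ∈⇒<m : ∀ (π : Permutation′ (suc m)) k {ℓ} → Sπ π k ℓ → ℓ < m
    ∈⇒<m π k (_ , hi) = ℕₚ.<-≤-trans hi (ℕₚ.⊔-lub (val≤ π (inject₁ k)) (val≤ π (suc k)))
    image⊆ : ∀ y → image φ (Sπ π k) y → Sπ τ k′ y
    image⊆ _ (x , x∈ , refl) = jump≢0⇒∈ u′ v′ (λ ≡0 → ∈⇒jump≢0 u v x∈ (trans (row (∈⇒<m π k x∈)) ≡0))
    ⊆image : ∀ y → Sπ τ k′ y → image φ (Sπ π k) y
    ⊆image y y∈ = φ y , jump≢0⇒∈ u v (λ ≡0 → ∈⇒jump≢0 u′ v′ y∈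
        (trans (cong (D τ k′) (sym (flipFun-involutive a b y)))
          (trans (sym (row (flipFun-bound a b≤m (∈⇒<m τ k′ y∈)))) ≡0)))
      , flipFun-involutive a b y

-- Following the pairs forth and back leads to a row with the same entries. Rows of `D` are pairwise
-- distinct, so the correspondence of rows is a bijection.
FlipStep⇒SameMatrix : ∀ {m} {π τ : Permutation′ (suc m)} → FlipStep π τ → SameMatrix π τ
FlipStep⇒SameMatrix {m} {π} {τ} (a , b , _ , b≤m , _ , there , back) = record
  { ρ = permutation to′ from′ to-from′ from-to′
  ; σ = toPerm (flipBij a b b≤m)
  ; match = λ k ℓ → trans (to-row k (toℕ ℓ)) (cong (D τ (to′ k)) (sym (toℕ-toPerm (flipBij a b b≤m) ℓ)))
  }
  where
  to′ from′ : Fin m → Fin m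
  to′ k = proj₁ (there k)
  from′ k′ = proj₁ (back k′)
  to-row : ∀ k ℓ → D π k ℓ ≡ D τ (to′ k) (flipFun a b ℓ)
  to-row k = pair⇒row π τ a b (proj₁ (proj₂ (there k))) (proj₂ (proj₂ (there k)))
  from-row : ∀ k′ ℓ → D π (from′ k′) ℓ ≡ D τ k′ (flipFun a b ℓ)
  from-row k′ = pair⇒row π τ a b (proj₁ (proj₂ (back k′))) (proj₂ (proj₂ (back k′)))
  from-to′ : ∀ k → from′ (to′ k) ≡ k
  from-to′ k = D-rows-distinct π (λ ℓ → trans (from-row (to′ k) ℓ) (sym (to-row k ℓ)))
  to-from′ : ∀ k′ → to′ (from′ k′) ≡ k′
  to-from′ k′ = D-rows-distinct τ (λ ℓ → subst (λ ℓ → D τ (to′ (from′ k′)) ℓ ≡ D τ k′ ℓ) (flipFun-involutive a b ℓ)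
    (trans (sym (to-row (from′ k′) _)) (from-row k′ _)))

SameMatrix⇒FlipStep : ∀ {m} {π τ : Permutation′ (suc m)} (S : SameMatrix π τ) {a b} → a < b → b ≤ m → ValidFlip π a b →
  (∀ ℓ → toℕ (SameMatrix.σ S ⟨$⟩ʳ ℓ) ≡ flipFun a b (toℕ ℓ)) → FlipStep π τ
SameMatrix⇒FlipStep {m} {π} {τ} S {a} {b} a<b b≤m valid σ≡φ = a , b , a<b , b≤m , valid ,
  (λ k → ρ ⟨$⟩ʳ k , row⇒pair π τ a b b≤m (row k)) ,
  (λ k′ → ρ ⟨$⟩ˡ k′ , row⇒pair π τ a b b≤m (subst (λ k → ∀ {ℓ} → ℓ < m → D π (ρ ⟨$⟩ˡ k′) ℓ ≡ D τ k (flipFun a b ℓ))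
    (inverseʳ ρ) (row (ρ ⟨$⟩ˡ k′))))
  where
  open SameMatrix S
  row : ∀ k {ℓ} → ℓ < m → D π k ℓ ≡ D τ (ρ ⟨$⟩ʳ k) (flipFun a b ℓ)
  row k ℓ<m = subst (λ ℓ → D π k ℓ ≡ D τ (ρ ⟨$⟩ʳ k) (flipFun a b ℓ)) (toℕ-fromℕ< ℓ<m)
    (trans (match k (fromℕ< ℓ<m)) (cong (D τ (ρ ⟨$⟩ʳ k)) (σ≡φ (fromℕ< ℓ<m))))

-- A permutation is only determined up to pointwise equality, which is absorbed by the trivial flip of [1,2].
σ≗id⇒FlipStep : ∀ {m} {π τ : Permutation′ (suc m)} (S : SameMatrix π τ) → 1 ≤ m →
  (∀ ℓ → SameMatrix.σ S ⟨$⟩ʳ ℓ ≡ ℓ) → FlipStep π τ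
σ≗id⇒FlipStep {m} {π} {τ} S 1≤m σ≗id = SameMatrix⇒FlipStep S (s≤s z≤n) 1≤m
  (singleton-laminar (Λ? _ _ 0) , λ k → laminar-singleton (Λ? _ _ 0))
  (λ ℓ → trans (cong toℕ (σ≗id ℓ)) (sym (trivial (toℕ ℓ))))
  where
  trivial : ∀ ℓ → flipFun 0 1 ℓ ≡ ℓ
  trivial zero = refl
  trivial (suc ℓ) = refl
  singleton-laminar : ∀ {A : LSet} → Dec (A 0) → Laminar (Λ 0 1) A
  singleton-laminar (yes 0∈A) = inj₁ (λ { zero _ → 0∈A ; (suc _) (_ , s≤s ()) })
  singleton-laminar (no 0∉A) = inj₂ (inj₂ (λ { zero _ → 0∉A ; (suc _) (_ , s≤s ()) }))
  laminar-singleton : ∀ {A : LSet} → Dec (A 0) → Laminar A (Λ 0 1)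
  laminar-singleton (yes 0∈A) = inj₂ (inj₁ (λ { zero _ → 0∈A ; (suc _) (_ , s≤s ()) }))
  laminar-singleton (no 0∉A) = inj₂ (inj₂ (λ { zero 0∈A _ → 0∉A 0∈A ; (suc _) _ (_ , s≤s ()) }))

-- Finding a valid flip

-- With u < v the endpoints of an interval, this excludes that [u,v] and [a,b] overlap properly.
NoCross : ℕ → ℕ → ℕ → ℕ → Set
NoCross a b u v = ¬ (u < a × a < v × v < b) × ¬ (a < u × u < b × b < v)

-- Levels are listed in the order of π; σ ℓ is the level of τ corresponding to ℓ.
module ValidReversal {m K} (lo hi : Fin K → ℕ) (hi≤m : ∀ i → hi i ≤ m) (s : Bij m)
  (convex : ∀ i {x y z} → to s x ≤ to s y → to s y ≤ to s z → Λ (lo i) (hi i) x → Λ (lo i) (hi i) z → Λ (lo i) (hi i) y)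
  {j : ℕ} (j<m : j < m) (prefix : ∀ {i} → i < j → to s i ≡ i) (j<σj : j < to s j) where

  private
    module S = Bij s
    σ = S.to
    t = S.from j

    σt≡j : σ t ≡ j
    σt≡j = S.to-from j

    t<m : t < m
    t<m = S.from< j<m

    suffix : ∀ {i} → j ≤ i → j ≤ σ i
    suffix {i} j≤i = ℕₚ.≮⇒≥ (λ σi<j → ℕₚ.<⇒≱ (subst (_< j) (S.to-injective (prefix σi<j)) σi<j) j≤i)

    j<t : j < t
    j<t = ℕₚ.≤∧≢⇒< (ℕₚ.≮⇒≥ (λ t<j → ℕₚ.<⇒≢ t<j (trans (sym (prefix t<j)) σt≡j)))
      (λ j≡t → ℕₚ.<⇒≢ j<σj (sym (trans (cong σ j≡t) σt≡j)))

    -- `below` is the invariant of the upward search for `β` from `t`, and `cut` is its stopping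
    -- condition. At the top level `cut` holds vacuously, as `suc β < m` fails there.
    record Cut : Set where
      field
        β : ℕ
        t≤β : t ≤ β
        β<m : β < m
        below : ∀ {y} → t ≤ y → y ≤ β → σ y < σ j
        cut : ∀ i → suc β < m → Λ (lo i) (hi i) β → Λ (lo i) (hi i) (suc β) → Λ (lo i) (hi i) j

    find-cut : ∀ d β → suc (β + d) ≡ m → t ≤ β → (∀ {y} → t ≤ y → y ≤ β → σ y < σ j) → Cut
    find-cut d β eq t≤β below
      with any? (λ i → Λ? (lo i) (hi i) β ×-dec (Λ? (lo i) (hi i) (suc β) ×-dec ¬? (Λ? (lo i) (hi i) j)))
    find-cut d β eq t≤β below | no none = record
      { β = β ; t≤β = t≤β ; β<m = subst (β <_) eq (s≤s (ℕₚ.m≤m+n β d)) ; below = below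
      ; cut = λ i _ ∋β ∋sβ → decidable-stable (Λ? _ _ j) (λ ∌j → none (i , ∋β , ∋sβ , ∌j)) }
    find-cut zero β eq t≤β below | yes _ = record
      { β = β ; t≤β = t≤β ; β<m = ℕₚ.≤-reflexive sβ≡m ; below = below
      ; cut = λ _ sβ<m → contradiction sβ≡m (ℕₚ.<⇒≢ sβ<m) }
      where sβ≡m = trans (cong suc (sym (ℕₚ.+-identityʳ β))) eq
    find-cut (suc d) β eq t≤β below | yes (i , ∋β , ∋sβ , ∌j) =
      find-cut d (suc β) (trans (cong suc (sym (ℕₚ.+-suc β d))) eq) (ℕₚ.m≤n⇒m≤1+n t≤β) below′
      where
      below′ : ∀ {y} → t ≤ y → y ≤ suc β → σ y < σ j
      below′ t≤y y≤sβ with ℕₚ.m≤n⇒m<n∨m≡n y≤sβ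
      ... | inj₁ y<sβ = below t≤y (ℕₚ.≤-pred y<sβ)
      -- Otherwise `σ β < σ j ≤ σ (suc β)`, and convexity would put `j` into set `i`, which contains
      -- `β` and `suc β` but not `j`.
      ... | inj₂ refl = ℕₚ.≰⇒> (λ σj≤σsβ → ∌j (convex i (ℕₚ.<⇒≤ (below t≤β ℕₚ.≤-refl)) σj≤σsβ ∋β ∋sβ))

  valid-reversal : ∃ λ β → j < β × β < m × σ β < σ j × (∀ i → NoCross j (suc β) (lo i) (hi i))
  valid-reversal = β , ℕₚ.<-≤-trans j<t t≤β , β<m , below t≤β ℕₚ.≤-refl , λ i → left i , right i
    where
    initial : Cut
    initial = find-cut (m ∸ suc t) t (ℕₚ.m+[n∸m]≡n t<m) ℕₚ.≤-refl
      (λ t≤y y≤t → subst (_< σ j) (trans (sym σt≡j) (cong σ (ℕₚ.≤-antisym t≤y y≤t))) j<σj)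
    open Cut initial
    -- Such a set contains `lo i` and `j`. As `σ (lo i) < j`, where `j` is `σ t`, and `j < σ j`, it
    -- contains `t` by convexity, so `t < hi i ≤ β` and `σ (hi i) < σ j` by `below`. Convexity then
    -- puts `hi i` itself into the set, which is absurd.
    left : ∀ i → ¬ (lo i < j × j < hi i × hi i < suc β)
    left i (lo<j , j<hi , s≤s hi≤β) = ℕₚ.<-irrefl refl (proj₂ ∋hi)
      where
      ∋lo = ℕₚ.≤-refl , ℕₚ.<-trans lo<j j<hi
      ∋j = ℕₚ.<⇒≤ lo<j , j<hi
      σlo<j = subst (_< j) (sym (prefix lo<j)) lo<j
      ∋t = convex i (ℕₚ.<⇒≤ (subst (σ (lo i) <_) (sym σt≡j) σlo<j)) (ℕₚ.<⇒≤ (subst (_< σ j) (sym σt≡j) j<σj)) ∋lo ∋j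
      ∋hi = convex i (ℕₚ.<⇒≤ (ℕₚ.<-≤-trans σlo<j (suffix (ℕₚ.<⇒≤ j<hi))))
        (ℕₚ.<⇒≤ (below (ℕₚ.<⇒≤ (proj₂ ∋t)) hi≤β)) ∋lo ∋j
    -- Such a set contains `β` and `suc β` but starts above `j`, against `cut`.
    right : ∀ i → ¬ (j < lo i × lo i < suc β × suc β < hi i)
    right i (j<lo , s≤s lo≤β , sβ<hi) = ℕₚ.<⇒≱ j<lo (proj₁ (cut i (ℕₚ.<-≤-trans sβ<hi (hi≤m i))
      (lo≤β , ℕₚ.<-trans (ℕₚ.n<1+n β) sβ<hi) (ℕₚ.m≤n⇒m≤1+n lo≤β , sβ<hi)))

NoCross⇒Laminar : ∀ {a b u v} → NoCross a b u v → Laminar (Λ u v) (Λ a b)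
NoCross⇒Laminar {a} {b} {u} {v} (not-left , not-right) with v ≤? a | b ≤? u | a ≤? u | v ≤? b
... | yes v≤a | _ | _ | _ = inj₂ (inj₂ (λ ℓ ∈S ∈I → ℕₚ.<⇒≱ (ℕₚ.<-≤-trans (proj₂ ∈S) v≤a) (proj₁ ∈I)))
... | no _ | yes b≤u | _ | _ = inj₂ (inj₂ (λ ℓ ∈S ∈I → ℕₚ.<⇒≱ (ℕₚ.<-≤-trans (proj₂ ∈I) b≤u) (proj₁ ∈S)))
... | no _ | no _ | yes a≤u | yes v≤b = inj₁ (λ ℓ ∈S → ℕₚ.≤-trans a≤u (proj₁ ∈S) , ℕₚ.<-≤-trans (proj₂ ∈S) v≤b)
... | no _ | no b≰u | _ | no v≰b =
  inj₂ (inj₁ (λ ℓ ∈I → ℕₚ.≤-trans u≤a (proj₁ ∈I) , ℕₚ.<-trans (proj₂ ∈I) (ℕₚ.≰⇒> v≰b)))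
  where u≤a = ℕₚ.≮⇒≥ (λ a<u → not-right (a<u , ℕₚ.≰⇒> b≰u , ℕₚ.≰⇒> v≰b))
... | no v≰a | no _ | no a≰u | yes _ =
  inj₂ (inj₁ (λ ℓ ∈I → ℕₚ.≤-trans (ℕₚ.≰⇒≥ a≰u) (proj₁ ∈I) , ℕₚ.<-≤-trans (proj₂ ∈I) b≤v))
  where b≤v = ℕₚ.≮⇒≥ (λ v<b → not-left (ℕₚ.≰⇒> a≰u , ℕₚ.≰⇒> v≰a , v<b))

Laminar-sym : ∀ {A B} → Laminar A B → Laminar B A
Laminar-sym (inj₁ A⊆B) = inj₂ (inj₁ A⊆B)
Laminar-sym (inj₂ (inj₁ B⊆A)) = inj₁ B⊆A
Laminar-sym (inj₂ (inj₂ disjoint)) = inj₂ (inj₂ (λ ℓ ∈B ∈A → disjoint ℓ ∈A ∈B))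

-- Performing a flip on a permutation

Inside : ℕ → ℕ → ℕ → Set
Inside a b v = a < v × v < b

Within : ℕ → ℕ → ℕ → Set
Within a b v = a ≤ v × v ≤ b

Inside? : ∀ a b v → Dec (Inside a b v)
Inside? a b v = (a <? v) ×-dec (v <? b)

-- An edge can leave the open interval only by stopping at one of its endpoints.
NoCross⇒Within : ∀ {a b} u v → NoCross a b (u ⊓ v) (u ⊔ v) → Inside a b u → Within a b v
NoCross⇒Within {a} {b} u v (not-left , not-right) (a<u , u<b) = ℕₚ.≮⇒≥ v≮a , ℕₚ.≮⇒≥ b≮v
  where
  v≮a : ¬ (v < a)
  v≮a v<a = not-left (subst (_< a) (sym (ℕₚ.m≥n⇒m⊓n≡n v≤u)) v<a ,
    subst (a <_) (sym (ℕₚ.m≥n⇒m⊔n≡m v≤u)) a<u , subst (_< b) (sym (ℕₚ.m≥n⇒m⊔n≡m v≤u)) u<b)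
    where v≤u = ℕₚ.<⇒≤ (ℕₚ.<-trans v<a a<u)
  b≮v : ¬ (b < v)
  b≮v b<v = not-right (subst (a <_) (sym (ℕₚ.m≤n⇒m⊓n≡m u≤v)) a<u ,
    subst (_< b) (sym (ℕₚ.m≤n⇒m⊓n≡m u≤v)) u<b , subst (b <_) (sym (ℕₚ.m≤n⇒m⊔n≡n u≤v)) b<v)
    where u≤v = ℕₚ.<⇒≤ (ℕₚ.<-trans u<b b<v)

NoCross⇒Within′ : ∀ {a b} u v → NoCross a b (u ⊓ v) (u ⊔ v) → Inside a b v → Within a b u
NoCross⇒Within′ {a} {b} u v nc = NoCross⇒Within v u (subst₂ (NoCross a b) (ℕₚ.⊓-comm u v) (ℕₚ.⊔-comm u v) nc)

-- Only the levels from `a` to `b - 1` move, and a value outside the open interval lies on the same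
-- side of all of them.
ind-flip : ∀ {a b u} → ¬ Inside a b u → ∀ ℓ → ind ℓ u ≡ ind (flipFun a b ℓ) u
ind-flip {a} {b} {u} out ℓ = by-cases (Λ? a b ℓ) (a <? u) (u <? b)
  where
  by-cases : Dec (Λ a b ℓ) → Dec (a < u) → Dec (u < b) → ind ℓ u ≡ ind (flipFun a b ℓ) u
  by-cases (no ∉) _ _ = cong (λ ℓ → ind ℓ u) (sym (flipFun-out ∉))
  by-cases (yes (a≤ℓ , ℓ<b)) (yes a<u) (yes u<b) = contradiction (a<u , u<b) out
  by-cases (yes (a≤ℓ , ℓ<b)) (no a≮u) _ =
    trans (ind-≥ (ℕₚ.≤-trans (ℕₚ.≮⇒≥ a≮u) a≤ℓ)) (sym (ind-≥ (ℕₚ.≤-trans (ℕₚ.≮⇒≥ a≮u) (flipFun-≥ a≤ℓ ℓ<b))))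
  by-cases (yes (a≤ℓ , ℓ<b)) _ (no u≮b) =
    trans (ind-< (ℕₚ.<-≤-trans ℓ<b (ℕₚ.≮⇒≥ u≮b))) (sym (ind-< (ℕₚ.<-≤-trans (flipFun-< a≤ℓ ℓ<b) (ℕₚ.≮⇒≥ u≮b))))

jump-kept : ∀ {a b u v} → ¬ Inside a b u → ¬ Inside a b v → ∀ ℓ → jump u v ℓ ≡ jump u v (flipFun a b ℓ)
jump-kept out-u out-v ℓ = cong₂ _-_ (ind-flip out-v ℓ) (ind-flip out-u ℓ)

Within-reflect : ∀ {a b u w} → w + u ≡ a + b → Within a b u → Within a b w
Within-reflect {a} {b} {u} {w} eq (a≤u , u≤b) =
  ℕₚ.+-cancelʳ-≤ b a w (subst (_≤ w + b) eq (ℕₚ.+-monoʳ-≤ w u≤b)) ,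
  ℕₚ.+-cancelˡ-≤ a w b (subst₂ _≤_ (ℕₚ.+-comm w a) eq (ℕₚ.+-monoʳ-≤ w a≤u))

ind-reflect : ∀ {a b u w ℓ} → w + u ≡ a + b → a ≤ ℓ → ℓ < b → ind (flipFun a b ℓ) w ≡ 1ℚ - ind ℓ u
ind-reflect {a} {b} {u} {w} {ℓ} eq a≤ℓ ℓ<b = by-cases (ℓ <? u)
  where
  φℓ = flipFun a b ℓ
  sum : suc ℓ + φℓ ≡ w + u
  sum = trans (flipFun-sum a≤ℓ ℓ<b) (sym eq)
  by-cases : Dec (ℓ < u) → ind φℓ w ≡ 1ℚ - ind ℓ u
  by-cases (yes ℓ<u) = trans (ind-≥ (ℕₚ.+-cancelʳ-≤ u w φℓ (subst₂ _≤_ sum (ℕₚ.+-comm u φℓ) (ℕₚ.+-monoˡ-≤ φℓ ℓ<u))))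
    (cong (λ z → 1ℚ - z) (sym (ind-< ℓ<u)))
  by-cases (no ℓ≮u) = trans (ind-< (ℕₚ.+-cancelʳ-≤ ℓ (suc φℓ) w
      (subst (_≤ w + ℓ) (trans (sym sum) (cong suc (ℕₚ.+-comm ℓ φℓ))) (ℕₚ.+-monoʳ-≤ w (ℕₚ.≮⇒≥ ℓ≮u)))))
    (cong (λ z → 1ℚ - z) (sym (ind-≥ (ℕₚ.≮⇒≥ ℓ≮u))))

-- Reflecting both levels and values reverses every comparison and so negates the jump; exchanging
-- the start and end of the edge restores its sign. At levels outside the interval both jumps
-- vanish.
jump-reflected : ∀ {a b u v u′ v′} → u′ + v ≡ a + b → v′ + u ≡ a + b → Within a b u → Within a b v →
  ∀ ℓ → jump u v ℓ ≡ jump u′ v′ (flipFun a b ℓ)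
jump-reflected {a} {b} {u} {v} {u′} {v′} eq-u eq-v in-u in-v ℓ = by-cases (a ≤? ℓ) (ℓ <? b)
  where
  in-u′ = Within-reflect eq-u in-v
  in-v′ = Within-reflect eq-v in-u
  by-cases : Dec (a ≤ ℓ) → Dec (ℓ < b) → jump u v ℓ ≡ jump u′ v′ (flipFun a b ℓ)
  by-cases (yes a≤ℓ) (yes ℓ<b) = sym (trans
    (cong₂ _-_ (ind-reflect {u = u} {v′} eq-v a≤ℓ ℓ<b) (ind-reflect {u = v} {u′} eq-u a≤ℓ ℓ<b))
    (solve 2 (λ x y → (con 1ℚ :- x) :- (con 1ℚ :- y) := y :- x) refl (ind ℓ u) (ind ℓ v)))
  by-cases (no a≰ℓ) _ = trans (cong₂ _-_ (above in-v) (above in-u))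
    (sym (trans (cong (jump u′ v′) (flipFun-out {a} {b} (λ (a≤ℓ , _) → a≰ℓ a≤ℓ)))
      (cong₂ _-_ (above in-v′) (above in-u′))))
    where
    above : ∀ {w} → Within a b w → ind ℓ w ≡ 1ℚ
    above (a≤w , _) = ind-< (ℕₚ.<-≤-trans (ℕₚ.≰⇒> a≰ℓ) a≤w)
  by-cases _ (no ℓ≮b) = trans (cong₂ _-_ (beneath in-v) (beneath in-u))
    (sym (trans (cong (jump u′ v′) (flipFun-out {a} {b} (λ (_ , ℓ<b) → ℓ≮b ℓ<b)))
      (cong₂ _-_ (beneath in-v′) (beneath in-u′))))
    where
    beneath : ∀ {w} → Within a b w → ind ℓ w ≡ 0ℚ
    beneath (_ , w≤b) = ind-≥ (ℕₚ.≤-trans w≤b (ℕₚ.≮⇒≥ ℓ≮b))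

data EdgeImage (a b u v u′ v′ : ℕ) : Set where
  kept : u′ ≡ u → v′ ≡ v → ¬ Inside a b u → ¬ Inside a b v → EdgeImage a b u v u′ v′
  reflected : u′ + v ≡ a + b → v′ + u ≡ a + b → Within a b u → Within a b v → EdgeImage a b u v u′ v′

jump-image : ∀ {a b u v u′ v′} → EdgeImage a b u v u′ v′ → ∀ ℓ → jump u v ℓ ≡ jump u′ v′ (flipFun a b ℓ)
jump-image (kept refl refl out-u out-v) = jump-kept out-u out-v
jump-image (reflected eq-u eq-v in-u in-v) = jump-reflected eq-u eq-v in-u in-v

-- Reversing the arcs of the closed path

record FlippedPath {m} (p : Bij (suc m)) (a b : ℕ) : Set where
  field
    path : Bij (suc m)
    edge : Bij m
    image-of : ∀ {k} → k < m → EdgeImage a b (to p k) (to p (suc k)) (to path (to edge k)) (to path (suc (to edge k)))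

-- `P` and `Q` are the positions of the values `a` and `b`, in either order. Removing them leaves a
-- middle arc and an outer arc, the latter running through the closing edge. `a+1<b` guarantees a
-- value strictly inside.
module FlipPath {m} (p : Bij (suc m)) {a b : ℕ} (a+1<b : suc a < b) (b≤m : b ≤ m)
  (edges : ∀ {k} → k < m → NoCross a b (to p k ⊓ to p (suc k)) (to p k ⊔ to p (suc k)))
  (closing : NoCross a b (to p 0 ⊓ to p m) (to p 0 ⊔ to p m))
  {P Q : ℕ} (P<Q : P < Q) (Q≤m : Q ≤ m)
  (ends : (to p P ≡ a × to p Q ≡ b) ⊎ (to p P ≡ b × to p Q ≡ a)) where

  private
    module p = Bij p
    f : ℕ → ℕ
    f = p.to
    In : ℕ → Set
    In i = Inside a b (f i)
    In? : ∀ i → Dec (In i)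
    In? i = Inside? a b (f i)
    Q<m+1 = s≤s Q≤m
    P≤m = ℕₚ.≤-trans (ℕₚ.<⇒≤ P<Q) Q≤m
    a<b = ℕₚ.<-trans (ℕₚ.n<1+n a) a+1<b

    Elsewhere : ℕ → Set
    Elsewhere i = i ≢ P × i ≢ Q

    fP+fQ : f P + f Q ≡ a + b
    fP+fQ = [ (λ (fP≡a , fQ≡b) → cong₂ _+_ fP≡a fQ≡b)
            , (λ (fP≡b , fQ≡a) → trans (cong₂ _+_ fP≡b fQ≡a) (ℕₚ.+-comm b a)) ]′ ends

    fQ+fP : f Q + f P ≡ a + b
    fQ+fP = trans (ℕₚ.+-comm (f Q) (f P)) fP+fQ

    end-values : ∀ {i} → i ≡ P ⊎ i ≡ Q → f i ≡ a ⊎ f i ≡ b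
    end-values (inj₁ refl) = [ inj₁ ∘ proj₁ , inj₂ ∘ proj₁ ]′ ends
    end-values (inj₂ refl) = [ inj₂ ∘ proj₂ , inj₁ ∘ proj₂ ]′ ends

    end-¬In : ∀ {i} → i ≡ P ⊎ i ≡ Q → ¬ In i
    end-¬In i∈ (a<fi , fi<b) with end-values i∈
    ... | inj₁ fi≡a = ℕₚ.<⇒≢ a<fi (sym fi≡a)
    ... | inj₂ fi≡b = ℕₚ.<⇒≢ fi<b fi≡b

    end-Within : ∀ {i} → i ≡ P ⊎ i ≡ Q → Within a b (f i)
    end-Within i∈ with end-values i∈
    ... | inj₁ fi≡a = subst (Within a b) (sym fi≡a) (ℕₚ.≤-refl , ℕₚ.<⇒≤ a<b)
    ... | inj₂ fi≡b = subst (Within a b) (sym fi≡b) (ℕₚ.<⇒≤ a<b , ℕₚ.≤-refl)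

    elsewhere-≢ : ∀ {i} → Elsewhere i → f i ≢ a × f i ≢ b
    elsewhere-≢ {i} (i≢P , i≢Q) =
      [ (λ (fP≡a , fQ≡b) → (λ fi≡a → i≢P (same fi≡a fP≡a)) , (λ fi≡b → i≢Q (same fi≡b fQ≡b)))
      , (λ (fP≡b , fQ≡a) → (λ fi≡a → i≢Q (same fi≡a fQ≡a)) , (λ fi≡b → i≢P (same fi≡b fP≡b))) ]′ ends
      where
      same : ∀ {i j v} → f i ≡ v → f j ≡ v → i ≡ j
      same fi≡v fj≡v = p.to-injective (trans fi≡v (sym fj≡v))

    Within⇒In : ∀ {i} → Elsewhere i → Within a b (f i) → In i
    Within⇒In else-i (a≤fi , fi≤b) with elsewhere-≢ else-i
    ... | fi≢a , fi≢b = ℕₚ.≤∧≢⇒< a≤fi (fi≢a ∘ sym) , ℕₚ.≤∧≢⇒< fi≤b fi≢b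

    In⇒Within : ∀ {i} → In i → Within a b (f i)
    In⇒Within (a<fi , fi<b) = ℕₚ.<⇒≤ a<fi , ℕₚ.<⇒≤ fi<b

    -- Away from `P` and `Q` the values `a` and `b` do not occur, so an edge starting inside, being
    -- confined to the closed interval, ends inside again.
    forward : ∀ {i} d → (∀ {k} → i ≤ k → k ≤ d + i → Elsewhere k) → d + i ≤ m → In i → In (d + i)
    forward zero _ _ in-i = in-i
    forward {i} (suc d) else-k ≤m in-i = Within⇒In (else-k (ℕₚ.m≤n+m i (suc d)) ℕₚ.≤-refl)
      (NoCross⇒Within (f (d + i)) (f (suc (d + i))) (edges ≤m)
        (forward d (λ lo hi → else-k lo (ℕₚ.m≤n⇒m≤1+n hi)) (ℕₚ.<⇒≤ ≤m) in-i))

    backward : ∀ {i} d → (∀ {k} → i ≤ k → k ≤ d + i → Elsewhere k) → d + i ≤ m → In (d + i) → In i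
    backward zero _ _ in-i = in-i
    backward {i} (suc d) else-k ≤m in-end = backward d (λ lo hi → else-k lo (ℕₚ.m≤n⇒m≤1+n hi)) (ℕₚ.<⇒≤ ≤m)
      (Within⇒In (else-k (ℕₚ.m≤n+m i d) (ℕₚ.n≤1+n _))
        (NoCross⇒Within′ (f (d + i)) (f (suc (d + i))) (edges ≤m) in-end))

    run : ∀ {i j} → i ≤ j → (∀ {k} → i ≤ k → k ≤ j → Elsewhere k) → j ≤ m → (In i → In j) × (In j → In i)
    run {i} {j} i≤j else-k j≤m =
      (λ in-i → subst In eq (forward (j ∸ i) else-k′ j≤m′ in-i)) ,
      (λ in-j → backward (j ∸ i) else-k′ j≤m′ (subst In (sym eq) in-j))
      where
      eq : (j ∸ i) + i ≡ j
      eq = ℕₚ.m∸n+n≡m i≤j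
      j≤m′ = subst (_≤ m) (sym eq) j≤m
      else-k′ : ∀ {k} → i ≤ k → k ≤ (j ∸ i) + i → Elsewhere k
      else-k′ {k} lo hi = else-k lo (subst (k ≤_) eq hi)

    Middle Outer : ℕ → Set
    Middle i = P < i × i < Q
    Outer i = i < P ⊎ (Q < i × i ≤ m)

    middle-elsewhere : ∀ {i} → Middle i → Elsewhere i
    middle-elsewhere (P<i , i<Q) = ℕₚ.<⇒≢ P<i ∘ sym , ℕₚ.<⇒≢ i<Q

    before-elsewhere : ∀ {i} → i < P → Elsewhere i
    before-elsewhere i<P = ℕₚ.<⇒≢ i<P , ℕₚ.<⇒≢ (ℕₚ.<-trans i<P P<Q)

    after-elsewhere : ∀ {i} → Q < i → Elsewhere i
    after-elsewhere Q<i = ℕₚ.<⇒≢ (ℕₚ.<-trans P<Q Q<i) ∘ sym , ℕₚ.<⇒≢ Q<i ∘ sym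

    outer-elsewhere : ∀ {i} → Outer i → Elsewhere i
    outer-elsewhere (inj₁ i<P) = before-elsewhere i<P
    outer-elsewhere (inj₂ (Q<i , _)) = after-elsewhere Q<i

    middle-run : ∀ {i} → Middle i → (In (suc P) → In i) × (In i → In (suc P))
    middle-run (P<i , i<Q) =
      run P<i (λ lo hi → middle-elsewhere (lo , ℕₚ.≤-<-trans hi i<Q)) (ℕₚ.<⇒≤ (ℕₚ.<-≤-trans i<Q Q≤m))

    middle-dichotomy : (∀ {i} → Middle i → In i) ⊎ (∀ {i} → Middle i → ¬ In i)
    middle-dichotomy with In? (suc P)
    ... | yes in-P+1 = inj₁ (λ mid → proj₁ (middle-run mid) in-P+1)
    ... | no ¬in-P+1 = inj₂ (λ mid in-i → ¬in-P+1 (proj₂ (middle-run mid) in-i))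

    before-run : ∀ {i} → i < P → (In 0 → In i) × (In i → In 0)
    before-run i<P = run z≤n (λ lo hi → before-elsewhere (ℕₚ.≤-<-trans hi i<P)) (ℕₚ.<⇒≤ (ℕₚ.<-≤-trans i<P P≤m))

    after-run : ∀ {i} → Q < i → i ≤ m → (In i → In m) × (In m → In i)
    after-run Q<i i≤m = run i≤m (λ lo hi → after-elsewhere (ℕₚ.<-≤-trans Q<i lo)) ℕₚ.≤-refl

    -- The positions before `P` and those after `Q` form a single arc: being inside is passed from
    -- one segment to the other by the closing edge between positions `0` and `m`.
    outer-dichotomy : (∀ {i} → Outer i → In i) ⊎ (∀ {i} → Outer i → ¬ In i)
    outer-dichotomy with In? 0 | In? m
    ... | no ¬in-0 | no ¬in-m = inj₂ λ
      { (inj₁ i<P) in-i → ¬in-0 (proj₂ (before-run i<P) in-i)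
      ; (inj₂ (Q<i , i≤m)) in-i → ¬in-m (proj₁ (after-run Q<i i≤m) in-i) }
    ... | yes in-0 | _ = inj₁ λ
      { (inj₁ i<P) → proj₁ (before-run i<P) in-0
      ; (inj₂ (Q<i , i≤m)) → proj₂ (after-run Q<i i≤m)
          (Within⇒In (after-elsewhere (ℕₚ.<-≤-trans Q<i i≤m)) (NoCross⇒Within (f 0) (f m) closing in-0)) }
    ... | no _ | yes in-m = inj₁ λ
      { (inj₁ i<P) → proj₁ (before-run i<P)
          (Within⇒In (before-elsewhere (ℕₚ.≤-<-trans z≤n i<P)) (NoCross⇒Within′ (f 0) (f m) closing in-m))
      ; (inj₂ (Q<i , i≤m)) → proj₂ (after-run Q<i i≤m) in-m }

    data Place (i : ℕ) : Set where
      end : i ≡ P ⊎ i ≡ Q → Place i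
      middle : Middle i → Place i
      outer : Outer i → Place i

    place : ∀ {i} → i ≤ m → Place i
    place {i} i≤m with ℕₚ.<-cmp i P | ℕₚ.<-cmp i Q
    ... | tri< i<P _ _ | _ = outer (inj₁ i<P)
    ... | tri≈ _ i≡P _ | _ = end (inj₁ i≡P)
    ... | tri> _ _ P<i | tri< i<Q _ _ = middle (P<i , i<Q)
    ... | tri> _ _ P<i | tri≈ _ i≡Q _ = end (inj₂ i≡Q)
    ... | tri> _ _ P<i | tri> _ _ Q<i = outer (inj₂ (Q<i , i≤m))

    between : ∀ {i} → P ≤ i → i ≤ Q → (i ≡ P ⊎ i ≡ Q) ⊎ Middle i
    between P≤i i≤Q with place (ℕₚ.≤-trans i≤Q Q≤m)
    ... | end e = inj₁ e
    ... | middle mid = inj₂ mid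
    ... | outer (inj₁ i<P) = contradiction P≤i (ℕₚ.<⇒≱ i<P)
    ... | outer (inj₂ (Q<i , _)) = contradiction i≤Q (ℕₚ.<⇒≱ Q<i)

    EndOrOuter : ℕ → Set
    EndOrOuter i = (i ≡ P ⊎ i ≡ Q) ⊎ Outer i

    not-between : ∀ {k} → k < m → ¬ Λ P Q k → EndOrOuter k × EndOrOuter (suc k)
    not-between {k} k<m out with k <? P
    ... | yes k<P = inj₂ (inj₁ k<P) , next (ℕₚ.m≤n⇒m<n∨m≡n k<P)
      where
      next : suc k < P ⊎ suc k ≡ P → EndOrOuter (suc k)
      next (inj₁ lt) = inj₂ (inj₁ lt)
      next (inj₂ eq) = inj₁ (inj₁ eq)
    ... | no k≮P = here (ℕₚ.m≤n⇒m<n∨m≡n Q≤k) , inj₂ (inj₂ (s≤s Q≤k , k<m))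
      where
      Q≤k : Q ≤ k
      Q≤k = ℕₚ.≮⇒≥ (λ k<Q → out (ℕₚ.≮⇒≥ k≮P , k<Q))
      here : Q < k ⊎ Q ≡ k → EndOrOuter k
      here (inj₁ lt) = inj₂ (inj₂ (lt , ℕₚ.<⇒≤ k<m))
      here (inj₂ eq) = inj₁ (inj₂ (sym eq))

    -- The upper bound of `flipFun` is exclusive: `suc Q` here, and `suc b` in `R`, give reflections
    -- of closed intervals.
    G : Bij (suc m)
    G = flipBij P (suc Q) Q<m+1

    G-between : ∀ {i i′} → P ≤ i → i ≤ Q → i + i′ ≡ P + Q → to G i ≡ i′
    G-between P≤i i≤Q eq = flipFun-≡ P≤i (s≤s i≤Q) (trans (cong suc eq) (sym (ℕₚ.+-suc P Q)))

    G-P : to G P ≡ Q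
    G-P = G-between ℕₚ.≤-refl (ℕₚ.<⇒≤ P<Q) refl

    G-Q : to G Q ≡ P
    G-Q = G-between (ℕₚ.<⇒≤ P<Q) ℕₚ.≤-refl (ℕₚ.+-comm Q P)

    G-outer : ∀ {i} → Outer i → to G i ≡ i
    G-outer (inj₁ i<P) = flipFun-out {P} {suc Q} (λ (P≤i , _) → ℕₚ.<⇒≱ i<P P≤i)
    G-outer (inj₂ (Q<i , _)) = flipFun-out {P} {suc Q} (λ { (_ , s≤s i≤Q) → ℕₚ.<⇒≱ Q<i i≤Q })

    mirror-between : ∀ {i i′} → P ≤ i → i ≤ Q → i + i′ ≡ P + Q → P ≤ i′ × i′ ≤ Q
    mirror-between {i} {i′} P≤i i≤Q eq = Within-reflect (trans (ℕₚ.+-comm i′ i) eq) (P≤i , i≤Q)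

    R : Bij (suc m)
    R = flipBij a (suc b) (s≤s b≤m)

    R-Within : ∀ {v} → Within a b v → to R v + v ≡ a + b
    R-Within {v} (a≤v , v≤b) = ℕₚ.suc-injective
      (trans (cong suc (ℕₚ.+-comm (to R v) v)) (trans (flipFun-sum a≤v (s≤s v≤b)) (ℕₚ.+-suc a b)))

    opposite-position : ∀ {k k′} → suc (k + k′) ≡ m → flipFun 0 (suc m) k ≡ suc k′ × flipFun 0 (suc m) (suc k) ≡ k′
    opposite-position {k} {k′} eq =
      flipFun-≡ z≤n (ℕₚ.<-trans k<m (ℕₚ.n<1+n m)) (cong suc (trans (ℕₚ.+-suc k k′) eq)) ,
      flipFun-≡ z≤n (s≤s k<m) (cong suc eq)
      where
      k<m : k < m
      k<m = subst (k <_) eq (s≤s (ℕₚ.m≤m+n k k′))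

  module MiddleInside (mid-in : ∀ {i} → Middle i → In i) (out-out : ∀ {i} → Outer i → ¬ In i) where
    -- On the middle arc each edge is reflected and traversed backwards. At `P` and `Q` the reversal
    -- of positions and the reflection of values cancel, so the outer edges attach as before.
    q : Bij (suc m)
    q = R ∘ᵇ (p ∘ᵇ G)

    between-Within : ∀ {i} → P ≤ i → i ≤ Q → Within a b (f i)
    between-Within P≤i i≤Q with between P≤i i≤Q
    ... | inj₁ e = end-Within e
    ... | inj₂ mid = In⇒Within (mid-in mid)

    q-kept : ∀ {i} → EndOrOuter i → to q i ≡ f i × ¬ In i
    q-kept (inj₁ (inj₁ refl)) = ℕₚ.+-cancelʳ-≡ (f Q) _ _
      (trans (cong (λ i → to R (f i) + f Q) G-P) (trans (R-Within (end-Within (inj₂ refl))) (sym fP+fQ))) ,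
      end-¬In (inj₁ refl)
    q-kept (inj₁ (inj₂ refl)) = ℕₚ.+-cancelʳ-≡ (f P) _ _
      (trans (cong (λ i → to R (f i) + f P) G-Q) (trans (R-Within (end-Within (inj₁ refl))) (sym fQ+fP))) ,
      end-¬In (inj₂ refl)
    q-kept {i} (inj₂ o) = trans (cong (λ i → to R (f i)) (G-outer o))
      (flipFun-out {a} {suc b} (λ { (a≤fi , s≤s fi≤b) → out-out o (Within⇒In (outer-elsewhere o) (a≤fi , fi≤b)) })) ,
      out-out o

    q-reflected : ∀ {i i′} → P ≤ i → i ≤ Q → i + i′ ≡ P + Q → to q i + f i′ ≡ a + b
    q-reflected {i} {i′} P≤i i≤Q eq = trans (cong (λ j → to R (f j) + f i′) (G-between P≤i i≤Q eq))
      (R-Within (between-Within (proj₁ i′∈) (proj₂ i′∈)))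
      where i′∈ = mirror-between P≤i i≤Q eq

    flipped : FlippedPath p a b
    flipped = record { path = q ; edge = flipBij P Q Q≤m ; image-of = λ {k} k<m → by-cases k<m (Λ? P Q k) }
      where
      by-cases : ∀ {k} → k < m → Dec (Λ P Q k) →
        EdgeImage a b (f k) (f (suc k)) (to q (flipFun P Q k)) (to q (suc (flipFun P Q k)))
      by-cases {k} k<m (yes (P≤k , k<Q)) = reflected
        (q-reflected P≤k′ (ℕₚ.<⇒≤ k′<Q) (trans (ℕₚ.+-suc k′ k) sum))
        (q-reflected (ℕₚ.m≤n⇒m≤1+n P≤k′) k′<Q sum)
        (between-Within P≤k (ℕₚ.<⇒≤ k<Q)) (between-Within (ℕₚ.m≤n⇒m≤1+n P≤k) k<Q)
        where
        k′ = flipFun P Q k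
        P≤k′ = flipFun-≥ P≤k k<Q
        k′<Q = flipFun-< P≤k k<Q
        sum : suc (k′ + k) ≡ P + Q
        sum = trans (cong suc (ℕₚ.+-comm k′ k)) (flipFun-sum P≤k k<Q)
      by-cases {k} k<m (no ∉) with not-between k<m ∉
      ... | here , next = kept
        (trans (cong (to q) (flipFun-out ∉)) (proj₁ (q-kept here)))
        (trans (cong (to q ∘ suc) (flipFun-out ∉)) (proj₁ (q-kept next)))
        (proj₂ (q-kept here)) (proj₂ (q-kept next))

  module OuterInside (mid-out : ∀ {i} → Middle i → ¬ In i) (out-in : ∀ {i} → Outer i → In i) where
    -- The lower bound `suc a` makes `R°` fix both `a` and `b` and reflect only the values strictly
    -- between them. Thus `q` has `a` and `b` exchanged, the outer arc reflected in place and the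
    -- middle arc backwards.
    R° q : Bij (suc m)
    R° = flipBij (suc a) b (ℕₚ.m≤n⇒m≤1+n b≤m)
    q = R° ∘ᵇ (p ∘ᵇ G)

    between-¬In : ∀ {i} → P ≤ i → i ≤ Q → ¬ In i
    between-¬In P≤i i≤Q with between P≤i i≤Q
    ... | inj₁ e = end-¬In e
    ... | inj₂ mid = mid-out mid

    q-reflected : ∀ {i} → EndOrOuter i → to q i + f i ≡ a + b × Within a b (f i)
    q-reflected (inj₁ (inj₁ refl)) = trans (cong (λ i → to R° (f i) + f P) G-P)
      (trans (cong (_+ f P) (flipFun-out (end-¬In (inj₂ refl)))) fQ+fP) , end-Within (inj₁ refl)
    q-reflected (inj₁ (inj₂ refl)) = trans (cong (λ i → to R° (f i) + f Q) G-Q)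
      (trans (cong (_+ f Q) (flipFun-out (end-¬In (inj₁ refl)))) fP+fQ) , end-Within (inj₂ refl)
    q-reflected {i} (inj₂ o) = trans (cong (λ j → to R° (f j) + f i) (G-outer o))
      (trans (ℕₚ.+-comm (to R° (f i)) (f i)) (ℕₚ.suc-injective (flipFun-sum (proj₁ (out-in o)) (proj₂ (out-in o))))) ,
      In⇒Within (out-in o)

    q-kept : ∀ {i i′} → P ≤ i → i ≤ Q → i + i′ ≡ P + Q → to q i ≡ f i′
    q-kept {i} {i′} P≤i i≤Q eq = trans (cong (λ j → to R° (f j)) (G-between P≤i i≤Q eq))
      (flipFun-out (between-¬In (proj₁ i′∈) (proj₂ i′∈)))
      where i′∈ = mirror-between P≤i i≤Q eq

    -- Reading all of `q` backwards restores the direction of the middle arc and reverses that of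
    -- the outer arc, as the signs demand.
    path : Bij (suc m)
    path = q ∘ᵇ flipBij 0 (suc m) ℕₚ.≤-refl
    edge : Bij m
    edge = flipBij 0 m ℕₚ.≤-refl ∘ᵇ flipBij P Q Q≤m

    path-at : ∀ {k k′} → k < m → flipFun 0 m k ≡ k′ → to path k′ ≡ to q (suc k) × to path (suc k′) ≡ to q k
    path-at {k} k<m refl = cong (to q) (proj₁ opp) , cong (to q) (proj₂ opp)
      where opp = opposite-position (trans (cong suc (ℕₚ.+-comm (flipFun 0 m k) k)) (flipFun-sum z≤n k<m))

    flipped : FlippedPath p a b
    flipped = record { path = path ; edge = edge ; image-of = λ {k} k<m → by-cases k<m (Λ? P Q k) }
      where
      by-cases : ∀ {k} → k < m → Dec (Λ P Q k) →
        EdgeImage a b (f k) (f (suc k)) (to path (to edge k)) (to path (suc (to edge k)))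
      by-cases {k} k<m (yes (P≤k , k<Q)) = kept
        (trans (proj₁ at) (q-kept (ℕₚ.m≤n⇒m≤1+n P≤k′) k′<Q sum))
        (trans (proj₂ at) (q-kept P≤k′ (ℕₚ.<⇒≤ k′<Q) (trans (ℕₚ.+-suc k′ k) sum)))
        (between-¬In P≤k (ℕₚ.<⇒≤ k<Q)) (between-¬In (ℕₚ.m≤n⇒m≤1+n P≤k) k<Q)
        where
        k′ = flipFun P Q k
        P≤k′ = flipFun-≥ P≤k k<Q
        k′<Q = flipFun-< P≤k k<Q
        at = path-at (ℕₚ.<-≤-trans k′<Q Q≤m) refl
        sum : suc (k′ + k) ≡ P + Q
        sum = trans (cong suc (ℕₚ.+-comm k′ k)) (flipFun-sum P≤k k<Q)
      by-cases {k} k<m (no ∉) with not-between k<m ∉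
      ... | here , next = reflected
        (trans (cong (_+ f (suc k)) (proj₁ at)) (proj₁ (q-reflected next)))
        (trans (cong (_+ f k) (proj₂ at)) (proj₁ (q-reflected here)))
        (proj₂ (q-reflected here)) (proj₂ (q-reflected next))
        where at = path-at k<m (cong (flipFun 0 m) (sym (flipFun-out ∉)))

  module AllInside (within : ∀ {i} → i ≤ m → Within a b (f i)) where
    path : Bij (suc m)
    path = R ∘ᵇ (p ∘ᵇ flipBij 0 (suc m) ℕₚ.≤-refl)

    flipped : FlippedPath p a b
    flipped = record { path = path ; edge = flipBij 0 m ℕₚ.≤-refl ; image-of = λ {k} k<m → reflected
        (trans (cong (λ i → to R (f i) + f (suc k)) (proj₁ (opp k<m))) (R-Within (within k<m)))
        (trans (cong (λ i → to R (f i) + f k) (proj₂ (opp k<m))) (R-Within (within (ℕₚ.<⇒≤ k<m))))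
        (within (ℕₚ.<⇒≤ k<m)) (within k<m) }
      where
      opp : ∀ {k} → k < m → flipFun 0 (suc m) (flipFun 0 m k) ≡ suc k × flipFun 0 (suc m) (suc (flipFun 0 m k)) ≡ k
      opp {k} k<m = opposite-position (trans (cong suc (ℕₚ.+-comm (flipFun 0 m k) k)) (flipFun-sum z≤n k<m))

  flipped-path : FlippedPath p a b
  flipped-path with middle-dichotomy | outer-dichotomy
  ... | inj₁ mid-in | inj₂ out-out = MiddleInside.flipped mid-in out-out
  ... | inj₂ mid-out | inj₁ out-in = OuterInside.flipped mid-out out-in
  ... | inj₁ mid-in | inj₁ out-in = AllInside.flipped within
    where
    within : ∀ {i} → i ≤ m → Within a b (f i)
    within i≤m with place i≤m
    ... | end e = end-Within e
    ... | middle mid = In⇒Within (mid-in mid)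
    ... | outer o = In⇒Within (out-in o)
  -- The value `suc a` is strictly inside and occurs somewhere on the path.
  ... | inj₂ mid-out | inj₂ out-out = contradiction interior nowhere
    where
    i = p.from (suc a)
    interior : In i
    interior = subst (Inside a b) (sym (p.to-from (suc a))) (ℕₚ.n<1+n a , a+1<b)
    nowhere : ¬ In i
    nowhere with place (ℕₚ.≤-pred (p.from< (s≤s (ℕₚ.≤-trans (ℕₚ.<⇒≤ a+1<b) b≤m))))
    ... | end e = end-¬In e
    ... | middle mid = mid-out mid
    ... | outer o = out-out o

flip-path : ∀ {m} (p : Bij (suc m)) {a b} → suc a < b → b ≤ m →
  (∀ {k} → k < m → NoCross a b (to p k ⊓ to p (suc k)) (to p k ⊔ to p (suc k))) →
  NoCross a b (to p 0 ⊓ to p m) (to p 0 ⊔ to p m) → FlippedPath p a b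
flip-path {m} p {a} {b} a+1<b b≤m edges closing with ℕₚ.<-cmp (from p a) (from p b)
... | tri< lt _ _ = FlipPath.flipped-path p a+1<b b≤m edges closing lt
  (ℕₚ.≤-pred (Bij.from< p (s≤s b≤m))) (inj₁ (Bij.to-from p a , Bij.to-from p b))
... | tri≈ _ eq _ = contradiction
  (trans (sym (Bij.to-from p a)) (trans (cong (to p) eq) (Bij.to-from p b))) (ℕₚ.<⇒≢ (ℕₚ.<-trans (ℕₚ.n<1+n a) a+1<b))
... | tri> _ _ gt = FlipPath.flipped-path p a+1<b b≤m edges closing gt
  (ℕₚ.≤-pred (Bij.from< p (s≤s (ℕₚ.≤-trans (ℕₚ.<⇒≤ (ℕₚ.<-trans (ℕₚ.n<1+n a) a+1<b)) b≤m))))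
  (inj₂ (Bij.to-from p b , Bij.to-from p a))

-- Sorting by valid flips

SameMatrix-trans : ∀ {m} {π τ υ : Permutation′ (suc m)} → SameMatrix π τ → SameMatrix τ υ → SameMatrix π υ
SameMatrix-trans S T = record
  { ρ = S.ρ ∘ₚ T.ρ
  ; σ = S.σ ∘ₚ T.σ
  ; match = λ k ℓ → trans (S.match k ℓ) (T.match (S.ρ ⟨$⟩ʳ k) (S.σ ⟨$⟩ʳ ℓ))
  }
  where
  module S = SameMatrix S
  module T = SameMatrix T

FlippedPath⇒SameMatrix : ∀ {m} (π : Permutation′ (suc m)) {a b} (b≤m : b ≤ m) → (F : FlippedPath (fromPerm π) a b) →
  ∃ λ π′ → Σ (SameMatrix π π′) λ S → ∀ ℓ → toℕ (SameMatrix.σ S ⟨$⟩ʳ ℓ) ≡ flipFun a b (toℕ ℓ)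
FlippedPath⇒SameMatrix {m} π {a} {b} b≤m F = toPerm path ,
  record { ρ = toPerm edge ; σ = toPerm φ ; match = match } , toℕ-toPerm φ
  where
  open FlippedPath F
  φ : Bij m
  φ = flipBij a b b≤m
  val-path : ∀ i → val (toPerm path) i ≡ to path (toℕ i)
  val-path = toℕ-toPerm path
  match : ∀ k (ℓ : Fin m) → D π k (toℕ ℓ) ≡ D (toPerm path) (toPerm edge ⟨$⟩ʳ k) (toℕ (toPerm φ ⟨$⟩ʳ ℓ))
  match k ℓ = begin
    jump (val π (inject₁ k)) (val π (suc k)) (toℕ ℓ)
      ≡⟨ cong₂ (λ u v → jump u v (toℕ ℓ)) (trans (sym (extend-toℕ π (inject₁ k))) (cong (extend π) (toℕ-inject₁ k)))
          (sym (extend-toℕ π (suc k))) ⟩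
    jump (extend π (toℕ k)) (extend π (suc (toℕ k))) (toℕ ℓ)
      ≡⟨ jump-image (image-of (toℕ<n k)) (toℕ ℓ) ⟩
    jump (to path (to edge (toℕ k))) (to path (suc (to edge (toℕ k)))) (flipFun a b (toℕ ℓ))
      ≡⟨ cong (jump (to path (to edge (toℕ k))) (to path (suc (to edge (toℕ k))))) (sym (toℕ-toPerm φ ℓ)) ⟩
    jump (to path (to edge (toℕ k))) (to path (suc (to edge (toℕ k)))) (toℕ (toPerm φ ⟨$⟩ʳ ℓ))
      ≡⟨ cong₂ (λ u v → jump u v (toℕ (toPerm φ ⟨$⟩ʳ ℓ)))
          (trans (cong (to path) (trans (sym (toℕ-toPerm edge k)) (sym (toℕ-inject₁ _)))) (sym (val-path _)))
          (trans (cong (to path ∘ suc) (sym (toℕ-toPerm edge k))) (sym (val-path _))) ⟩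
    D (toPerm path) (toPerm edge ⟨$⟩ʳ k) (toℕ (toPerm φ ⟨$⟩ʳ ℓ)) ∎
    where open ≡-Reasoning

-- The closing edge and convexity of the family

Z-last : ∀ {m} (x : Fin m → ℚ) → Z x (fromℕ m) ≡ Σℚ.sum x
Z-last {zero} x = refl
Z-last {suc m} x = cong (x zero +ℚ_) (Z-last (x ∘ suc))

-- The edges of π together with the edge closing the path, at index 0.
start finish : ∀ {m} → Permutation′ (suc m) → Fin (suc m) → ℕ
start π zero = val π zero
start π (suc k) = val π (inject₁ k)
finish {m} π zero = val π (fromℕ m)
finish π (suc k) = val π (suc k)

-- The steps along the path telescope. The closing row, being the sum of all rows, is therefore
-- respected by every matching of the matrices.
closing-jump : ∀ {m} (π : Permutation′ (suc m)) ℓ → jump (start π zero) (finish π zero) ℓ ≡ Σℚ.sum (λ k → D π k ℓ)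
closing-jump {m} π ℓ = trans (sym (Z-gap (λ i → step ℓ (π ⟨$⟩ʳ i)) (fromℕ m))) (Z-last (λ k → D π k ℓ))

module _ {m} {π τ : Permutation′ (suc m)} (S : SameMatrix π τ) where
  open SameMatrix S

  closed-ρ : Fin (suc m) → Fin (suc m)
  closed-ρ zero = zero
  closed-ρ (suc k) = suc (ρ ⟨$⟩ʳ k)

  closed-match : ∀ i (ℓ : Fin m) →
    jump (start π i) (finish π i) (toℕ ℓ) ≡ jump (start τ (closed-ρ i)) (finish τ (closed-ρ i)) (toℕ (σ ⟨$⟩ʳ ℓ))
  closed-match (suc k) ℓ = match k ℓ
  closed-match zero ℓ = begin
    jump (start π zero) (finish π zero) (toℕ ℓ)                       ≡⟨ closing-jump π (toℕ ℓ) ⟩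
    Σℚ.sum (λ k → D π k (toℕ ℓ))                                      ≡⟨ Σℚ.sum-cong-≗ (λ k → match k ℓ) ⟩
    Σℚ.sum (λ k → D τ (ρ ⟨$⟩ʳ k) (toℕ (σ ⟨$⟩ʳ ℓ)))
      ≡⟨ sym (Σℚ.sum-permute (λ k → D τ k (toℕ (σ ⟨$⟩ʳ ℓ))) ρ) ⟩
    Σℚ.sum (λ k → D τ k (toℕ (σ ⟨$⟩ʳ ℓ)))                             ≡⟨ sym (closing-jump τ (toℕ (σ ⟨$⟩ʳ ℓ))) ⟩
    jump (start τ zero) (finish τ zero) (toℕ (σ ⟨$⟩ʳ ℓ))              ∎
    where open ≡-Reasoning

  levels : Bij m
  levels = fromPerm σ

  closed-match-< : ∀ i {ℓ} → ℓ < m →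
    jump (start π i) (finish π i) ℓ ≡ jump (start τ (closed-ρ i)) (finish τ (closed-ρ i)) (to levels ℓ)
  closed-match-< i {ℓ} ℓ<m = trans (cong (jump (start π i) (finish π i)) (sym (toℕ-fromℕ< ℓ<m)))
    (trans (closed-match i (fromℕ< ℓ<m))
      (cong (jump (start τ (closed-ρ i)) (finish τ (closed-ρ i))) (sym (extend-< σ ℓ<m))))

lower upper : ∀ {m} → Permutation′ (suc m) → Fin (suc m) → ℕ
lower π i = start π i ⊓ finish π i
upper π i = start π i ⊔ finish π i

upper≤ : ∀ {m} (π : Permutation′ (suc m)) i → upper π i ≤ m
upper≤ {m} π zero = ℕₚ.⊔-lub (val≤ π zero) (val≤ π (fromℕ m))
upper≤ π (suc k) = ℕₚ.⊔-lub (val≤ π (inject₁ k)) (val≤ π (suc k))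

-- Through `σ`, set `i` corresponds to the level set of edge `closed-ρ S i` of `τ`, which is an
-- interval.
closed-convex : ∀ {m} {π τ : Permutation′ (suc m)} (S : SameMatrix π τ) i {x y z} →
  to (levels S) x ≤ to (levels S) y → to (levels S) y ≤ to (levels S) z →
  Λ (lower π i) (upper π i) x → Λ (lower π i) (upper π i) z → Λ (lower π i) (upper π i) y
closed-convex {m} {π} {τ} S i {x} {y} {z} σx≤σy σy≤σz x∈ z∈ =
  jump≢0⇒∈ (start π i) (finish π i) (λ ≡0 → ∈⇒jump≢0 (start τ i′) (finish τ i′) σy∈
    (trans (sym (closed-match-< S i y<m)) ≡0))
  where
  i′ = closed-ρ S i
  s = levels S
  image∈ : ∀ {w} → Λ (lower π i) (upper π i) w → Λ (lower τ i′) (upper τ i′) (to s w)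
  image∈ w∈ = jump≢0⇒∈ (start τ i′) (finish τ i′) (λ ≡0 → ∈⇒jump≢0 (start π i) (finish π i) w∈
    (trans (closed-match-< S i (ℕₚ.<-≤-trans (proj₂ w∈) (upper≤ π i))) ≡0))
  σy∈ : Λ (lower τ i′) (upper τ i′) (to s y)
  σy∈ = ℕₚ.≤-trans (proj₁ (image∈ x∈)) σx≤σy , ℕₚ.≤-<-trans σy≤σz (proj₂ (image∈ z∈))
  -- The bound is pulled back from the image of `y`, which is a level of `τ`.
  y<m : y < m
  y<m = subst (_< m) (Bij.from-to s y) (Bij.from< s (ℕₚ.<-≤-trans (proj₂ σy∈) (upper≤ τ i′)))

flip-step : ∀ {m} (π : Permutation′ (suc m)) {a b} → suc a < b → b ≤ m → (∀ i → NoCross a b (lower π i) (upper π i)) →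
  ∃ λ π′ → FlipStep π π′ × Σ (SameMatrix π π′) λ S → ∀ ℓ → toℕ (SameMatrix.σ S ⟨$⟩ʳ ℓ) ≡ flipFun a b (toℕ ℓ)
flip-step {m} π {a} {b} a+1<b b≤m noCross
  with FlippedPath⇒SameMatrix π b≤m (flip-path (fromPerm π) a+1<b b≤m edges closing)
  where
  start-edge : ∀ {k} (k<m : k < m) → start π (suc (fromℕ< k<m)) ≡ extend π k
  start-edge k<m = trans (sym (extend-toℕ π _)) (cong (extend π) (trans (toℕ-inject₁ _) (toℕ-fromℕ< k<m)))
  finish-edge : ∀ {k} (k<m : k < m) → finish π (suc (fromℕ< k<m)) ≡ extend π (suc k)
  finish-edge k<m = trans (sym (extend-toℕ π _)) (cong (extend π ∘ suc) (toℕ-fromℕ< k<m))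
  edges : ∀ {k} → k < m → NoCross a b (extend π k ⊓ extend π (suc k)) (extend π k ⊔ extend π (suc k))
  edges k<m =
    subst₂ (λ u v → NoCross a b (u ⊓ v) (u ⊔ v)) (start-edge k<m) (finish-edge k<m) (noCross (suc (fromℕ< k<m)))
  closing : NoCross a b (extend π 0 ⊓ extend π m) (extend π 0 ⊔ extend π m)
  closing = subst₂ (λ u v → NoCross a b (u ⊓ v) (u ⊔ v)) (sym (extend-toℕ π zero))
    (trans (sym (extend-toℕ π (fromℕ m))) (cong (extend π) (toℕ-fromℕ m))) (noCross zero)
... | π′ , S , σ≡φ = π′ , SameMatrix⇒FlipStep S (ℕₚ.<-trans (ℕₚ.n<1+n a) a+1<b) b≤m valid σ≡φ , S , σ≡φ
  where
  valid : ValidFlip π a b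
  valid = Laminar-sym (NoCross⇒Laminar (noCross zero)) , λ k → NoCross⇒Laminar (noCross (suc k))

Sorted : ∀ {m} {π τ : Permutation′ (suc m)} → ℕ → SameMatrix π τ → Set
Sorted j S = ∀ {i} → i < j → to (levels S) i ≡ i

-- The flip is an involution, so the remaining matching is `σ` after `φ`. It agrees with `σ` below
-- `j`, which `φ` fixes, and sends `j` to `σ β`, since the bounds `j` and `suc β` make `φ` exchange
-- `j` and `β`.
improve : ∀ {m} {π τ : Permutation′ (suc m)} (S : SameMatrix π τ) {j} → j < m → Sorted j S → j < to (levels S) j →
  ∃ λ π′ → FlipStep π π′ × Σ (SameMatrix π′ τ) λ S′ → Sorted j S′ × to (levels S′) j < to (levels S) j
improve {m} {π} {τ} S {j} j<m sorted j<σj = result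
  (ValidReversal.valid-reversal (lower π) (upper π) (upper≤ π) (levels S) (closed-convex S) j<m sorted j<σj)
  where
  module Reversal {π′} {β} (j<β : j < β) (T : SameMatrix π π′)
    (σ≡φ : ∀ ℓ → toℕ (SameMatrix.σ T ⟨$⟩ʳ ℓ) ≡ flipFun j (suc β) (toℕ ℓ)) where
    S′ : SameMatrix π′ τ
    S′ = SameMatrix-trans (SameMatrix-sym T) S
    φ : ℕ → ℕ
    φ = flipFun j (suc β)
    φj≡β : φ j ≡ β
    φj≡β = flipFun-≡ ℕₚ.≤-refl (s≤s (ℕₚ.<⇒≤ j<β)) (sym (ℕₚ.+-suc j β))
    σT⁻¹≡φ : ∀ ℓ → toℕ (SameMatrix.σ T ⟨$⟩ˡ ℓ) ≡ φ (toℕ ℓ)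
    σT⁻¹≡φ ℓ = trans (sym (flipFun-involutive j (suc β) _))
      (cong φ (trans (sym (σ≡φ _)) (cong toℕ (inverseʳ (SameMatrix.σ T)))))
    σ′-< : ∀ {i} → i < m → to (levels S′) i ≡ to (levels S) (φ i)
    σ′-< {i} i<m = trans (extend-< (SameMatrix.σ S′) i<m) (trans (sym (extend-toℕ (SameMatrix.σ S) _))
      (cong (extend (SameMatrix.σ S)) (trans (σT⁻¹≡φ _) (cong φ (toℕ-fromℕ< i<m)))))
    sorted′ : Sorted j S′
    sorted′ {i} i<j = trans (σ′-< (ℕₚ.<-trans i<j j<m))
      (trans (cong (to (levels S)) (flipFun-out {j} {suc β} (λ (j≤i , _) → ℕₚ.<⇒≱ i<j j≤i))) (sorted i<j))
    σ′j≡σβ : to (levels S′) j ≡ to (levels S) β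
    σ′j≡σβ = trans (σ′-< j<m) (cong (to (levels S)) φj≡β)

  result : (∃ λ β → j < β × β < m × to (levels S) β < to (levels S) j ×
      (∀ i → NoCross j (suc β) (lower π i) (upper π i))) →
    ∃ λ π′ → FlipStep π π′ × Σ (SameMatrix π′ τ) λ S′ → Sorted j S′ × to (levels S′) j < to (levels S) j
  result (β , j<β , β<m , σβ<σj , noCross) = finish-with (flip-step π (s≤s j<β) β<m noCross)
    where
    finish-with : (∃ λ π′ → FlipStep π π′ × Σ (SameMatrix π π′) λ T →
        ∀ ℓ → toℕ (SameMatrix.σ T ⟨$⟩ʳ ℓ) ≡ flipFun j (suc β) (toℕ ℓ)) →
      ∃ λ π′ → FlipStep π π′ × Σ (SameMatrix π′ τ) λ S′ → Sorted j S′ × to (levels S′) j < to (levels S) j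
    finish-with (π′ , π→π′ , T , σ≡φ) =
      π′ , π→π′ , S′ , sorted′ , subst (_< to (levels S) j) (sym σ′j≡σβ) σβ<σj
      where open Reversal j<β T σ≡φ

-- The outer recursion is on the number `d` of levels from `j` upwards; the inner `loop` is on a
-- strict upper bound `c` for the image of `j`, which every flip decreases.
sort : ∀ {m} → 1 ≤ m → ∀ d {j} → j + d ≡ m → {π τ : Permutation′ (suc m)} (S : SameMatrix π τ) →
  Sorted j S → FlipReachable π τ
sort {m} 1≤m zero {j} eq S sorted = σ≗id⇒FlipStep S 1≤m
  (λ ℓ → toℕ-injective (trans (sym (extend-toℕ (SameMatrix.σ S) ℓ))
    (sorted (subst (toℕ ℓ <_) (sym (trans (sym (ℕₚ.+-identityʳ j)) eq)) (toℕ<n ℓ))))) ◅ ε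
sort {m} 1≤m (suc d) {j} eq {_} {τ} S sorted = loop m S sorted (Bij.to< (levels S) j<m)
  where
  j<m : j < m
  j<m = subst (j <_) eq (ℕₚ.m<m+n j (s≤s z≤n))
  loop : ∀ c {π} (S : SameMatrix π τ) → Sorted j S → to (levels S) j < c → FlipReachable π τ
  loop (suc c) {π} S sorted (s≤s σj≤c) = by-cases (ℕₚ.<-cmp j (to (levels S) j))
    where
    by-cases : Tri (j < to (levels S) j) (j ≡ to (levels S) j) (to (levels S) j < j) → FlipReachable π τ
    by-cases (tri≈ _ j≡σj _) = sort 1≤m d (trans (sym (ℕₚ.+-suc j d)) eq) S sorted′
      where
      sorted′ : Sorted (suc j) S
      sorted′ (s≤s i≤j) with ℕₚ.m≤n⇒m<n∨m≡n i≤j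
      ... | inj₁ i<j = sorted i<j
      ... | inj₂ refl = sym j≡σj
    -- The level `σ j` would be fixed by `σ`, so injectivity would force it to equal `j`.
    by-cases (tri> _ j≢σj σj<j) = contradiction (sym (Bij.to-injective (levels S) (sorted σj<j))) j≢σj
    by-cases (tri< j<σj _ _) = continue (improve S j<m sorted j<σj)
      where
      continue : (∃ λ π′ → FlipStep π π′ ×
        Σ (SameMatrix π′ τ) λ S′ → Sorted j S′ × to (levels S′) j < to (levels S) j) →
        FlipReachable π τ
      continue (π′ , π→π′ , S′ , sorted′ , smaller) = π→π′ ◅ loop c S′ sorted′ (ℕₚ.<-≤-trans smaller σj≤c)

FlipReachable⇒∼ : ∀ {m} {π τ : Permutation′ (suc m)} → FlipReachable π τ → π ∼ τ
FlipReachable⇒∼ {π = π} ε = ∼-refl {π = π}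
FlipReachable⇒∼ {π = π} {τ} (_◅_ {j = π′} π→π′ π′→*τ) =
  ∼-trans {π = π} {π′} {τ} (SameMatrix⇒∼ (FlipStep⇒SameMatrix {π = π} {π′} π→π′)) (FlipReachable⇒∼ {π = π′} {τ} π′→*τ)

theorem3p3 : (m : ℕ) → 1 ≤ m → (π τ : Permutation′ (suc m)) →
    (π ∼ τ) ⇔ FlipReachable π τ
theorem3p3 m 1≤m π τ = mk⇔
  (λ π∼τ → sort 1≤m m refl (∼⇒SameMatrix π∼τ) (λ ()))
  (FlipReachable⇒∼ {π = π} {τ})
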